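{- Each of the sets $\mathcal{D}_0$ and $\mathcal{D}\cap[1,2]$ is equal to the set of all values $\delta(\psi)$, where $\psi$ ranges over all reduced functions (over all alphabets $\mathcal{A}$ disjoint from $\mathbb{N}^*$).
   Context: Words are over an arbitrary alphabet disjoint from $\mathbb{N}^*=\{1,2,\dots\}$; the empty word is a palindrome. For an infinite word $w$ with infinitely many palindromic prefixes, let $(n_i)_{i\ge1}$ be the increasing sequence of lengths of its palindromic prefixes ($n_1=0$) and $\delta(w)=\limsup n_{i+1}/n_i$; otherwise $\delta(w)=+\infty$. $w$ has abundant palindromic prefixes if it has infinitely many palindromic prefixes and $n_{i+1}\le 2n_i+1$ for all $i$. $\mathcal{D}$ is the set of values $\delta(w)$ over all infinite words; $\mathcal{D}_0$ the set of values $\delta(w)$ over words with abundant palindromic prefixes. A function here is a map $\psi:\mathbb{N}^*\to\mathbb{N}^*\sqcup\mathcal{A}$ with, for each $n\ge1$, either $\psi(n)\in\mathcal{A}$ or $1\le\psi(n)\le n-1$. Let $(t_k)_{k\ge0}$ be the (finite or infinite) increasing enumeration of all $n\ge1$ with $1\le\psi(n)\le n-2$ or $\psi(n)\in\mathcal{A}$. $\psi$ is reduced if for every $k\ge1$ such that $t_k$ exists: $\psi(t_k)\ne\psi(t_{k-1})$, and either $\psi(t_k)\in\mathcal{A}$ or $\psi(t_k)<t_{k-1}$. For reduced $\psi$, let $n_1=0$ and $n_{i+1}=2n_i-n_{\psi(i)}$ if $\psi(i)\in\mathbb{N}^*$, $n_{i+1}=2n_i+1$ if $\psi(i)\in\mathcal{A}$;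 then $\delta(\psi)=\limsup n_{i+1}/n_i$. -}

module Defs where

open import Level using (0ℓ)
open import Data.Nat using (ℕ; zero; suc; _+_; _*_; _∸_; _≤_; _<_)
open import Data.Integer using (+_)
open import Data.Rational as ℚ using (ℚ; _/_)
open import Data.List using (List; []; _∷_; _++_)
open import Data.Sum using (_⊎_; inj₁; inj₂)
open import Data.Product using (Σ; _×_; ∃; ∃-syntax)
open import Relation.Nullary using (¬_)
open import Relation.Binary.PropositionalEquality using (_≡_; _≢_)

Word : Set → Set
Word A = ℕ → A

PalPrefix : {A : Set} → Word A → ℕ → Set
PalPrefix w m = ∀ i → i < m → w i ≡ w (m ∸ suc i)

-- n is the increasing enumeration of all lengths of palindromic
-- prefixes of w, and there are infinitely many of them.
-- Index shift: n 0 is the paper's n_1 (= 0), n i is the paper's n_{i+1}.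
IsPalEnum : {A : Set} → Word A → (ℕ → ℕ) → Set
IsPalEnum w n =
  (∀ i → n i < n (suc i)) ×
  (∀ i → PalPrefix w (n i)) ×
  (∀ m → PalPrefix w m → ∃[ i ] n i ≡ m)

AbundantSeq : (ℕ → ℕ) → Set
AbundantSeq n = ∀ i → n (suc i) ≤ 2 * n i + 1

-- limsup of n (i+1) / n i, described through rational cuts.
-- (limsup_i n(i+1)/n(i)) < q  iff  ∃ q' < q with n(i+1)/n(i) ≤ q'
-- for all large i.  Written multiplicatively: n(i+1) ≤ q' * n(i)
-- (for i ≥ 1 we have n i > 0, so this is exactly n(i+1)/n(i) ≤ q').

toℚ : ℕ → ℚ
toℚ a = (+ a) / 1

LimsupLt : (ℕ → ℕ) → ℚ → Set
LimsupLt n q =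
  ∃[ q' ] (q' ℚ.< q ×
    ∃[ N ] (∀ i → N ≤ i → toℚ (n (suc i)) ℚ.≤ q' ℚ.* toℚ (n i)))

SameLimsup : (ℕ → ℕ) → (ℕ → ℕ) → Set
SameLimsup n m = ∀ q → (LimsupLt n q → LimsupLt m q) × (LimsupLt m q → LimsupLt n q)

LimsupIn12 : (ℕ → ℕ) → Set
LimsupIn12 n = (¬ LimsupLt n (toℚ 1)) × (∀ q → toℚ 2 ℚ.< q → LimsupLt n q)

-- Functions ψ : ℕ* → ℕ* ⊔ A.  Represented as ℕ → ℕ ⊎ A; the value at 0
-- is never used (0 ∉ ℕ*).

IsFunction : {A : Set} → (ℕ → ℕ ⊎ A) → Set
IsFunction ψ = ∀ n → 1 ≤ n → ∀ m → ψ n ≡ inj₁ m → (1 ≤ m) × (m + 1 ≤ n)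

IsLetter : {A : Set} → ℕ ⊎ A → Set
IsLetter {A} x = ∃[ a ] x ≡ inj₂ {B = A} a

Special : {A : Set} → (ℕ → ℕ ⊎ A) → ℕ → Set
Special ψ n = (1 ≤ n) × (IsLetter (ψ n) ⊎ ∃[ m ] (ψ n ≡ inj₁ m × (1 ≤ m) × (m + 2 ≤ n)))

IsReduced : {A : Set} → (ℕ → ℕ ⊎ A) → Set
IsReduced ψ =
  IsFunction ψ ×
  (∀ s t → s < t → Special ψ s → Special ψ t →
     (∀ j → s < j → j < t → ¬ Special ψ j) →
     (ψ t ≢ ψ s) × (IsLetter (ψ t) ⊎ ∃[ p ] (ψ t ≡ inj₁ p × p < s)))

-- The sequence attached to ψ: seqψ ψ k is the paper's n_{k+1};
-- n_1 = 0, n_{i+1} = 2 n_i - n_{ψ(i)} if ψ(i) ∈ ℕ*, 2 n_i + 1 if ψ(i) ∈ A.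
nth : List ℕ → ℕ → ℕ
nth [] _ = 0
nth (x ∷ xs) zero = x
nth (x ∷ xs) (suc k) = nth xs k

private
  stepψ : {A : Set} → (ℕ → ℕ ⊎ A) → ℕ → List ℕ → ℕ
  stepψ ψ k l with ψ (suc k)
  ... | inj₁ m = 2 * nth l k ∸ nth l (m ∸ 1)
  ... | inj₂ _ = 2 * nth l k + 1

firsts : {A : Set} → (ℕ → ℕ ⊎ A) → ℕ → List ℕ
firsts ψ zero = 0 ∷ []
firsts ψ (suc k) = firsts ψ k ++ (stepψ ψ k (firsts ψ k) ∷ [])

seqψ : {A : Set} → (ℕ → ℕ ⊎ A) → ℕ → ℕ
seqψ ψ k = nth (firsts ψ k) k

{-# OPTIONS --safe #-}
-- Palindromic prefixes of a palindrome correspond to its periods, so nᵢ₊₁ ≤ 2nᵢ forces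
-- nᵢ₊₁ = 2nᵢ − nⱼ for some j < i, and every word gives a reference function φ (with a letter
-- wherever nᵢ₊₁ > 2nᵢ).  It is reduced, since otherwise the period of the next palindrome
-- would be a proper multiple of the present one, and a palindrome would have been skipped.
-- Conversely, a reduced φ with pairwise distinct letters builds a word, and the same period
-- argument together with a weak Fine–Wilf theorem excludes further palindromic prefixes.
--
-- The lengths n of a word that is not abundant may differ from the lengths n′ generated by
-- its φ.  When the limsup is below 2 there are eventually no letters, and then both sequences
-- of gaps Dᵢ = nᵢ₊₁ − nᵢ satisfy Dᵢ = Σ { D_l | φ(i) ≤ l < i }.  So D′ᵢ / Dᵢ is a weighted mean
-- of the earlier quotients, and every sufficiently late jump k (where Dₖ ≥ nₖ / 4)
-- contracts their range by a fixed factor; hence the quotients converge and the two limsups agree.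
-- If jumps stop, the quotients are constant.  When the limsup is not below 2 both are 2.
module Submission where

open import Defs
open import Data.Empty using (⊥; ⊥-elim)
open import Data.Integer as ℤ using (-[1+_])
import Data.Integer.Properties as ℤ
open import Data.List using ([]; _∷_; _++_; length)
open import Data.List.Properties using (length-++)
open import Data.Maybe using (Maybe; just; nothing)
open import Data.Maybe.Properties using (just-injective)
open import Data.Nat
open import Data.Nat.Coprimality using (Coprime)
open import Data.Nat.Divisibility using (_∣_; divides; ∣m∣n⇒∣m+n; ∣m+n∣m⇒∣n; ∣-refl; ∣-trans; _∣0; n∣m*n; ∣⇒≤)
open import Data.Nat.Induction using (<-rec)
open import Data.Nat.Properties
open import Data.Nat.Tactic.RingSolver using (solve-∀)
open import Data.Product using (_×_; _,_; proj₁; proj₂; ∃-syntax)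
open import Data.Rational as ℚ using (mkℚ; fromℚᵘ; toℚᵘ)
open import Data.Rational.Properties using (toℚᵘ-fromℚᵘ; toℚᵘ-mono-≤; toℚᵘ-cancel-≤; toℚᵘ-mono-<; toℚᵘ-cancel-<; toℚᵘ-homo-*)
open import Data.Rational.Unnormalised as ℚᵘ using (mkℚᵘ)
import Data.Rational.Unnormalised.Properties as ℚᵘ
open import Data.Sum using (_⊎_; inj₁; inj₂; [_,_]′)
open import Function using (_∘_)
open import Relation.Binary.Definitions using (tri<; tri≈; tri>)
open import Relation.Binary.PropositionalEquality
open import Relation.Nullary using (¬_; Dec; yes; no; contradiction)

-- Reference functions

-- Indices are shifted by one: φ k ≡ just j encodes the paper's ψ(k+1) = j+1, and nothing a letter.
-- The jumps are the paper's t_k.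
Jump : (ℕ → Maybe ℕ) → ℕ → Set
Jump φ k = ∀ j → φ k ≡ just j → suc j < k

jump? : ∀ φ k → Dec (Jump φ k)
jump? φ k with φ k
... | nothing = yes λ _ ()
... | just j with suc j <? k
...   | yes p = yes λ { _ refl → p }
...   | no ¬p = no λ f → ¬p (f j refl)

module BackwardRefs {φ : ℕ → Maybe ℕ} (below : ∀ {k j} → φ k ≡ just j → j < k) where

  ¬jump : ∀ {k} → ¬ Jump φ k → ∃[ j ] (φ k ≡ just j × k ≡ suc j)
  ¬jump {k} ¬J with φ k in eq
  ... | nothing = ⊥-elim (¬J λ _ ())
  ... | just j with m≤n⇒m<n∨m≡n (below eq)
  ...   | inj₁ lt = ⊥-elim (¬J λ { _ refl → lt })
  ...   | inj₂ e = j , refl , sym e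

  -- A reference from 0 would have to go below 0, so 0 carries a letter; the search for the last
  -- jump stops here.
  jump-zero : Jump φ 0
  jump-zero j eq = contradiction (below eq) λ ()

  noJump-suc : ∀ {s i} → (∀ l → s < l → l ≤ i → ¬ Jump φ l) → ¬ Jump φ (suc i) →
    ∀ l → s < l → l ≤ suc i → ¬ Jump φ l
  noJump-suc none ¬J l p q with m≤n⇒m<n∨m≡n q
  ... | inj₁ (s≤s q′) = none l p q′
  ... | inj₂ refl = ¬J

  lastJump : ∀ i → ∃[ s ] (s ≤ i × Jump φ s × (∀ l → s < l → l ≤ i → ¬ Jump φ l))
  lastJump zero = 0 , z≤n , jump-zero , λ l p q → contradiction (≤-trans p q) λ ()
  lastJump (suc i) with jump? φ (suc i)
  ... | yes J = suc i , ≤-refl , J , λ l p q → contradiction p (≤⇒≯ q)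
  ... | no ¬J with lastJump i
  ...   | s , s≤i , J , none = s , m≤n⇒m≤1+n s≤i , J , noJump-suc none ¬J

-- Letters carry no identity here and count as pairwise distinct, so the condition on consecutive
-- jumps is stated for references.
record Reduced (φ : ℕ → Maybe ℕ) : Set where
  field
    below : ∀ {k j} → φ k ≡ just j → j < k
    consecutive : ∀ {s t j} → s < t → Jump φ s → Jump φ t →
      (∀ l → s < l → l < t → ¬ Jump φ l) → φ t ≡ just j → (j < s) × (φ s ≢ just j)

  open BackwardRefs below public

-- Sequences generated by a reference function

gap : (ℕ → ℕ) → ℕ → ℕ
gap y i = y (suc i) ∸ y i

-- A letter gives a lower bound only, because a word that is not abundant may grow beyond
-- `2 * y i + 1`. The reference rule is a sum, which avoids truncated subtraction.
record Tracks (φ : ℕ → Maybe ℕ) (y : ℕ → ℕ) : Set where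
  field
    incr : ∀ i → y i < y (suc i)
    letter : ∀ {i} → φ i ≡ nothing → y i + y i < y (suc i)
    ref : ∀ {i j} → φ i ≡ just j → y (suc i) + y j ≡ y i + y i

module Increasing {y : ℕ → ℕ} (incr : ∀ i → y i < y (suc i)) where

  y+gap : ∀ i → y i + gap y i ≡ y (suc i)
  y+gap i = m+[n∸m]≡n (<⇒≤ (incr i))

  gap>0 : ∀ i → 0 < gap y i
  gap>0 i = m<n⇒0<n∸m (incr i)

  y-mono : ∀ {i j} → i ≤ j → y i ≤ y j
  y-mono {j = zero} z≤n = ≤-refl
  y-mono {i} {suc j} i≤j with m≤n⇒m<n∨m≡n i≤j
  ... | inj₁ (s≤s p) = ≤-trans (y-mono p) (<⇒≤ (incr j))
  ... | inj₂ refl = ≤-refl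

  y-mono< : ∀ {i j} → i < j → y i < y j
  y-mono< {i} i<j = <-≤-trans (incr i) (y-mono i<j)

  y-cancel< : ∀ {i j} → y i < y j → i < j
  y-cancel< {i} {j} p with i <? j
  ... | yes q = q
  ... | no ¬q = contradiction (y-mono (≮⇒≥ ¬q)) (<⇒≱ p)

  y-injective : ∀ {i j} → y i ≡ y j → i ≡ j
  y-injective {i} {j} e with <-cmp i j
  ... | tri< p _ _ = contradiction e (<⇒≢ (y-mono< p))
  ... | tri≈ _ e′ _ = e′
  ... | tri> _ _ p = contradiction (sym e) (<⇒≢ (y-mono< p))

  i≤y : ∀ i → i ≤ y i
  i≤y zero = z≤n
  i≤y (suc i) = ≤-<-trans (i≤y i) (incr i)

  between : ∀ {i l} → y i < y l → y l < y (suc i) → ⊥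
  between p q = <⇒≱ (y-cancel< q) (y-cancel< p)

  locate : y 0 ≡ 0 → ∀ m → ∃[ i ] (y i ≤ m × m < y (suc i))
  locate y0 zero = 0 , ≤-reflexive y0 , ≤-<-trans z≤n (incr 0)
  locate y0 (suc m) with locate y0 m
  ... | i , p , q with m≤n⇒m<n∨m≡n q
  ...   | inj₁ r = i , m≤n⇒m≤1+n p , r
  ...   | inj₂ e = suc i , ≤-reflexive (sym e) , subst (_< y (2 + i)) (sym e) (incr (suc i))

  arithmetic : ∀ {d} j a → (∀ l → j ≤ l → l < j + a → gap y l ≡ d) → y (j + a) ≡ y j + a * d
  arithmetic j zero c = trans (cong y (+-identityʳ j)) (sym (+-identityʳ _))
  arithmetic {d} j (suc a) c = begin
      y (j + suc a)               ≡⟨ cong y (+-suc j a) ⟩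
      y (suc (j + a))             ≡⟨ y+gap (j + a) ⟨
      y (j + a) + gap y (j + a)   ≡⟨ cong₂ _+_ (arithmetic j a λ l p q → c l p (<-trans q (subst (j + a <_) (sym (+-suc j a)) ≤-refl)))
                                              (c (j + a) (m≤m+n j a) (subst (j + a <_) (sym (+-suc j a)) ≤-refl)) ⟩
      y j + a * d + d             ≡⟨ lemma (y j) (a * d) d ⟩
      y j + suc a * d             ∎
    where
    open ≡-Reasoning
    lemma : ∀ u v d → u + v + d ≡ u + (d + v)
    lemma = solve-∀

module Tracking {φ : ℕ → Maybe ℕ} {y : ℕ → ℕ} (below : ∀ {k j} → φ k ≡ just j → j < k) (T : Tracks φ y) where
  open BackwardRefs below
  open Tracks T public
  open Increasing incr public

  gap-ref : ∀ {i j} → φ i ≡ just j → gap y i + y j ≡ y i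
  gap-ref {i} {j} eq = +-cancelˡ-≡ (y i) _ _ (begin
      y i + (gap y i + y j)   ≡⟨ +-assoc (y i) _ _ ⟨
      y i + gap y i + y j     ≡⟨ cong (_+ y j) (y+gap i) ⟩
      y (suc i) + y j         ≡⟨ ref eq ⟩
      y i + y i               ∎)
    where open ≡-Reasoning

  -- Outside the jumps the reference is to the immediate predecessor, so the sequence continues
  -- arithmetically.
  gap-step : ∀ {i} → ¬ Jump φ (suc i) → gap y (suc i) ≡ gap y i
  gap-step {i} ¬J with ¬jump ¬J
  ... | j , eq , refl = +-cancelʳ-≡ (y i) _ _ (trans (gap-ref eq) (trans (sym (y+gap i)) (+-comm (y i) _)))

  gap-const : ∀ {s l} → s ≤ l → (∀ k → s < k → k ≤ l → ¬ Jump φ k) → gap y l ≡ gap y s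
  gap-const {l = zero} z≤n none = refl
  gap-const {s} {suc l} s≤l none with m≤n⇒m<n∨m≡n s≤l
  ... | inj₂ refl = refl
  ... | inj₁ (s≤s p) = trans (gap-step (none (suc l) (s≤s p) ≤-refl))
                             (gap-const p λ k q r → none k q (m≤n⇒m≤1+n r))

-- Periods and palindromes

Pal : {A : Set} → Word A → ℕ → Set
Pal w m = ∀ i k → suc (i + k) ≡ m → w i ≡ w k

Period : {A : Set} → Word A → ℕ → ℕ → Set
Period w m p = ∀ i → i + p < m → w i ≡ w (i + p)

module _ {A : Set} {w : Word A} where

  prefix⇒pal : ∀ {m} → PalPrefix w m → Pal w m
  prefix⇒pal P i k refl = trans (P i (s≤s (m≤m+n i k))) (cong w (m+n∸m≡n i k))

  pal⇒prefix : ∀ {m} → Pal w m → PalPrefix w m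
  pal⇒prefix P i i<m = P i _ (m+[n∸m]≡n i<m)

  -- Reflecting in the shorter palindrome and then in the longer one is translation by `p`.
  pal⇒period : ∀ {m} p → Pal w (m + p) → Pal w m → Period w (m + p) p
  pal⇒period {m} p Q P i lt = trans (P i k e) (sym (Q (i + p) k (trans (lemma i p k) (cong (_+ p) e))))
    where
    i<m = +-cancelʳ-< p i m lt
    k = m ∸ suc i
    e : suc (i + k) ≡ m
    e = m+[n∸m]≡n i<m
    lemma : ∀ i p k → suc (i + p + k) ≡ suc (i + k) + p
    lemma = solve-∀

  period⇒pal : ∀ {m p} → Pal w (m + p) → Period w (m + p) p → Pal w m
  period⇒pal {m} {p} P Q i k refl =
    trans (P i (k + p) (cong suc (sym (+-assoc i k p))))
          (sym (Q k (+-monoˡ-< p (s≤s (m≤n+m k i)))))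

  period-≤ : ∀ {m m′ p} → m ≤ m′ → Period w m′ p → Period w m p
  period-≤ le P i lt = P i (<-≤-trans lt le)

  period-* : ∀ {m d} a → Period w m d → Period w m (a * d)
  period-* zero P i lt = cong w (sym (+-identityʳ i))
  period-* {m} {d} (suc a) P i lt = trans (P i (≤-<-trans (+-monoʳ-≤ i (m≤m+n d (a * d))) lt))
    (trans (period-* a P (i + d) (subst (_< m) (sym (+-assoc i d _)) lt)) (cong w (+-assoc i d _)))

  -- The first `suc a * d` letters form whole blocks of length `d`, so repeating them with the long
  -- period continues the short one.
  period-extend : ∀ {m m′ d} a → Period w m d → suc a * d ≤ m → Period w m′ (suc a * d) → Period w m′ d
  period-extend {d = zero} a P le Q i lt = cong w (sym (+-identityʳ i))
  period-extend {m} {m′} {suc d-1} a P le Q = <-rec _ go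
    where
    d = suc d-1
    c = suc a * d
    go : ∀ i → (∀ {i′} → i′ < i → i′ + d < m′ → w i′ ≡ w (i′ + d)) → i + d < m′ → w i ≡ w (i + d)
    go i rec lt with i + d <? m
    ... | yes lt′ = P i lt′
    ... | no ¬lt with i <? c
    -- Here `i + d` is out of reach of the short period: go back by `a * d` with it, then forward by
    -- `c` with the long one.
    ...   | yes i<c = begin
              w i             ≡⟨ cong w x+ad ⟨
              w (x + a * d)   ≡⟨ period-* a P x (subst (_< m) (sym x+ad) (<-≤-trans i<c le)) ⟨
              w x             ≡⟨ Q x (subst (_< m′) (sym x+c) lt) ⟩
              w (x + c)       ≡⟨ cong w x+c ⟩
              w (i + d)       ∎
      where
      open ≡-Reasoning
      ad≤i : a * d ≤ i
      ad≤i = +-cancelʳ-≤ d _ _ (≤-trans (≤-reflexive (+-comm (a * d) d)) (≤-trans le (≮⇒≥ ¬lt)))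
      x = i ∸ a * d
      x+ad : x + a * d ≡ i
      x+ad = m∸n+n≡m ad≤i
      lemma : ∀ x u d → x + (d + u) ≡ x + u + d
      lemma = solve-∀
      x+c : x + c ≡ i + d
      x+c = trans (lemma x (a * d) d) (cong (_+ d) x+ad)
    ...   | no i≮c = begin
              w i             ≡⟨ cong w x+c ⟨
              w (x + c)       ≡⟨ Q x (subst (_< m′) (sym x+c) (≤-<-trans (m≤m+n i d) lt)) ⟨
              w x             ≡⟨ rec x<i (≤-<-trans (+-monoˡ-≤ d (<⇒≤ x<i)) lt) ⟩
              w (x + d)       ≡⟨ Q (x + d) (subst (_< m′) (sym x+d+c) lt) ⟩
              w (x + d + c)   ≡⟨ cong w x+d+c ⟩
              w (i + d)       ∎
      where
      open ≡-Reasoning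
      x = i ∸ c
      x+c : x + c ≡ i
      x+c = m∸n+n≡m (≮⇒≥ i≮c)
      x<i : x < i
      x<i = subst (x <_) x+c (m<m+n x (s≤s z≤n))
      lemma : ∀ x c d → x + d + c ≡ x + c + d
      lemma = solve-∀
      x+d+c : x + d + c ≡ i + d
      x+d+c = trans (lemma x c d) (cong (_+ d) x+c)

  -- The subtraction step of Euclid's algorithm. Near the start one first moves right by `q + r`,
  -- elsewhere first left by `q`, so the path stays inside the prefix.
  period-∸ : ∀ {m q r} → Period w m (q + r) → Period w m q → q + r + q ≤ m → Period w m r
  period-∸ {m} {q} {r} P Q le i lt with i <? q
  ... | yes i<q = trans (P i lt₁) (trans (cong w (lemma i q r)) (sym (Q (i + r) (subst (_< m) (lemma i q r) lt₁))))
    where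
    lemma : ∀ i q r → i + (q + r) ≡ i + r + q
    lemma = solve-∀
    lt₁ : i + (q + r) < m
    lt₁ = <-≤-trans (+-monoˡ-< (q + r) i<q) (≤-trans (≤-reflexive (+-comm q (q + r))) le)
  ... | no i≮q = trans (cong w (sym x+q)) (trans (sym (Q x (subst (_< m) (sym x+q) (≤-<-trans (m≤m+n i r) lt))))
                   (trans (P x (subst (_< m) (sym x+q+r) lt)) (cong w x+q+r)))
    where
    x = i ∸ q
    x+q : x + q ≡ i
    x+q = m∸n+n≡m (≮⇒≥ i≮q)
    x+q+r : x + (q + r) ≡ i + r
    x+q+r = trans (sym (+-assoc x q r)) (cong (_+ r) x+q)

  -- A weak form of the Fine–Wilf theorem.
  least-period-∣ : ∀ {m d} → (∀ p → 0 < p → p < d → ¬ Period w m p) → 0 < d → Period w m d →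
    ∀ p → Period w m p → p + d ≤ m → d ∣ p
  least-period-∣ {m} {d} least d>0 D = <-rec _ go
    where
    go : ∀ p → (∀ {p′} → p′ < p → Period w m p′ → p′ + d ≤ m → d ∣ p′) → Period w m p → p + d ≤ m → d ∣ p
    go zero rec P le = d ∣0
    go p@(suc _) rec P le with p <? d
    ... | yes p<d = ⊥-elim (least p (s≤s z≤n) p<d P)
    ... | no p≮d = subst (d ∣_) d+r (∣m∣n⇒∣m+n ∣-refl
            (rec r<p (period-∸ (subst (Period w m) (sym d+r) P) D (subst (λ x → x + d ≤ m) (sym d+r) le))
                 (≤-trans (+-monoˡ-≤ d (<⇒≤ r<p)) le)))
      where
      r = p ∸ d
      d+r : d + r ≡ p
      d+r = m+[n∸m]≡n (≮⇒≥ p≮d)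
      r<p : r < p
      r<p = subst (r <_) d+r (m<n+m r d>0)

  -- A period `p < d` would leave a palindrome of length `m + d - p`, strictly between the two
  -- lengths.
  noPal⇒least : ∀ {m d} → Pal w (m + d) → (∀ r → m < r → r < m + d → ¬ Pal w r) →
    ∀ p → 0 < p → p < d → ¬ Period w (m + d) p
  noPal⇒least {m} {d} P none p p>0 p<d Q =
    none (m + r) (m<m+n m (m<n⇒0<n∸m p<d)) (+-monoʳ-< m (∸-monoʳ-< {d} p>0 (<⇒≤ p<d)))
      (period⇒pal (subst (Pal w) (sym e) P) (subst (λ x → Period w x p) (sym e) Q))
    where
    r = d ∸ p
    e : m + r + p ≡ m + d
    e = trans (+-assoc m r p) (cong (m +_) (m∸n+n≡m (<⇒≤ p<d)))

  -- Otherwise the period d would extend to the longer palindrome and yield one in between.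
  noMultiple : ∀ {m d} a → (∀ r → m < r → r < m + (2 + a) * d → ¬ Pal w r) → 0 < d →
    Pal w m → Period w m d → (2 + a) * d ≤ m → ¬ Pal w (m + (2 + a) * d)
  noMultiple {m} {d} a none d>0 P Q le P′ =
    none _ (m<m+n m (<-≤-trans d>0 (m≤m+n d (a * d)))) (subst (m + suc a * d <_) e (m<m+n _ d>0))
      (period⇒pal {m = m + suc a * d} {p = d} (subst (Pal w) (sym e) P′) (subst (λ x → Period w x d) (sym e)
        (period-extend (suc a) Q le (pal⇒period _ P′ P))))
    where
    lemma : ∀ m u d → m + u + d ≡ m + (d + u)
    lemma = solve-∀
    e : m + suc a * d + d ≡ m + (2 + a) * d
    e = lemma m (suc a * d) d

-- The word of a reduced reference function

properMultiple : ∀ {d p} → d ∣ p → d < p → ∃[ a ] p ≡ (2 + a) * d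
properMultiple (divides 0 refl) ()
properMultiple {d} (divides 1 refl) lt = contradiction (+-identityʳ d) (<⇒≢ lt ∘ sym)
properMultiple (divides (suc (suc a)) e) lt = a , e

module WordFrom {φ : ℕ → Maybe ℕ} {n : ℕ → ℕ} (R : Reduced φ) (T : Tracks φ n) (n0 : n 0 ≡ 0)
  (letter-exact : ∀ {i} → φ i ≡ nothing → n (suc i) ≡ suc (n i + n i)) where

  open Reduced R
  open Tracking below T

  -- W k is the prefix of length n k followed by the constant letter k, which is new:
  -- this marker becomes the middle letter of the next palindrome when φ k ≡ nothing.
  W : ℕ → ℕ → ℕ
  W zero x = 0
  W (suc k) x with x <? n k
  ... | yes _ = W k x
  ... | no _ with x <? n (suc k)
  ...   | yes _ = W k (n (suc k) ∸ suc x)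
  ...   | no _ = suc k

  W-old : ∀ {k x} → x < n k → W (suc k) x ≡ W k x
  W-old {k} {x} lt with x <? n k
  ... | yes _ = refl
  ... | no ¬lt = contradiction lt ¬lt

  W-new : ∀ {k x z} → n k ≤ x → suc (x + z) ≡ n (suc k) → W (suc k) x ≡ W k z
  W-new {k} {x} {z} le e with x <? n k
  ... | yes lt = contradiction le (<⇒≱ lt)
  ... | no _ with x <? n (suc k)
  ...   | yes _ = cong (W k) (trans (cong (_∸ suc x) (sym e)) (m+n∸m≡n (suc x) z))
  ...   | no ¬lt = contradiction (subst (x <_) e (s≤s (m≤m+n x z))) ¬lt

  W-out : ∀ k {x} → n k ≤ x → W k x ≡ k
  W-out zero le = refl
  W-out (suc k) {x} le with x <? n k
  ... | yes lt = contradiction (<-≤-trans (incr k) le) (<⇒≯ lt)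
  ... | no _ with x <? n (suc k)
  ...   | yes lt = contradiction le (<⇒≱ lt)
  ...   | no _ = refl

  -- These bounds make the letter `k` new. The weak one is needed because the mirror image of a
  -- position may be the marker at `n k` itself.
  W-< : ∀ k {x} → x < n k → W k x < k
  W-≤ : ∀ k x → W k x ≤ k
  W-< zero {x} lt = contradiction (subst (x <_) n0 lt) λ ()
  W-< (suc k) {x} lt with x <? n k
  ... | yes _ = s≤s (W-≤ k x)
  ... | no _ with x <? n (suc k)
  ...   | yes _ = s≤s (W-≤ k _)
  ...   | no ¬lt = contradiction lt ¬lt
  W-≤ k x with x <? n k
  ... | yes lt = <⇒≤ (W-< k lt)
  ... | no ¬lt = ≤-reflexive (W-out k (≮⇒≥ ¬lt))

  W-stable : ∀ {k l x} → x < n k → k ≤ l → W l x ≡ W k x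
  W-stable {l = zero} lt z≤n = refl
  W-stable {k} {suc l} lt le with m≤n⇒m<n∨m≡n le
  ... | inj₂ refl = refl
  ... | inj₁ (s≤s le′) = trans (W-old (<-≤-trans lt (y-mono le′))) (W-stable lt le′)

  -- Position `x` is already final at stage `suc x`, since `x < n (suc x)`.
  word : Word ℕ
  word x = W (suc x) x

  word≡W : ∀ k {x} → x < n k → word x ≡ W k x
  word≡W k {x} lt with ≤-total k (suc x)
  ... | inj₁ le = W-stable lt le
  ... | inj₂ ge = sym (W-stable (i≤y (suc x)) ge)

  n-abundant : ∀ k → n (suc k) ≤ suc (n k + n k)
  n-abundant k with φ k in eq
  ... | nothing = ≤-reflexive (letter-exact eq)
  ... | just j = m≤n⇒m≤1+n (subst (n (suc k) ≤_) (ref eq) (m≤m+n _ _))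

  -- As `n (suc k)` is at most `2 * n k + 1`, the mirror image of `i` lies in the old prefix, unless
  -- both positions are the middle `n k`.
  mirror : ∀ k {i z} → suc (i + z) ≡ n (suc k) → n k ≤ i → word i ≡ word z
  mirror k {i} {z} e le with z <? n k
  ... | yes lt = trans (word≡W (suc k) (subst (i <_) e (s≤s (m≤m+n i z))))
                   (trans (W-new le e) (sym (word≡W k lt)))
  ... | no ¬lt = cong word (trans (sym i≡) z≡)
    where
    z≥ = ≮⇒≥ ¬lt
    sum≤ : i + z ≤ n k + n k
    sum≤ = s≤s⁻¹ (subst (_≤ suc (n k + n k)) (sym e) (n-abundant k))
    i≡ : n k ≡ i
    i≡ = ≤-antisym le (+-cancelʳ-≤ (n k) _ _ (≤-trans (+-monoʳ-≤ i z≥) sum≤))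
    z≡ : n k ≡ z
    z≡ = ≤-antisym z≥ (+-cancelˡ-≤ (n k) _ _ (≤-trans (+-monoˡ-≤ z le) sum≤))

  -- Stated for all `l ≤ k`, so that the recursion also supplies the palindrome that is referred to.
  word-pal-≤ : ∀ k l → l ≤ k → Pal word (n l)
  word-pal-≤ k zero le i z e = contradiction (trans e n0) λ ()
  word-pal-≤ (suc k) (suc l) (s≤s le) i z e with n l ≤? i | n l ≤? z
  ... | yes p | _ = mirror l e p
  ... | no _ | yes q = sym (mirror l (trans (cong suc (+-comm z i)) e) q)
  ... | no ¬p | no ¬q with φ l in eq
  ...   | nothing = contradiction (trans e (letter-exact eq)) (<⇒≢ (s≤s (+-mono-< (≰⇒> ¬p) (≰⇒> ¬q))))
  -- Both positions lie in the old prefix. Their reflections in the palindrome of length `n l` are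
  -- mirror images in the one of length `n j`, because `n (suc l) + n j` is `2 * n l`.
  ...   | just j = trans (P i i′ ei) (trans (word-pal-≤ k j (≤-trans (<⇒≤ (below eq)) le) i′ z′ ej) (sym (P z z′ ez)))
    where
    P = word-pal-≤ k l le
    i′ = n l ∸ suc i
    z′ = n l ∸ suc z
    ei : suc (i + i′) ≡ n l
    ei = m+[n∸m]≡n (≰⇒> ¬p)
    ez : suc (z + z′) ≡ n l
    ez = m+[n∸m]≡n (≰⇒> ¬q)
    lemma : ∀ i i′ z z′ → suc (i + z) + suc (i′ + z′) ≡ suc (i + i′) + suc (z + z′)
    lemma = solve-∀
    ej : suc (i′ + z′) ≡ n j
    ej = +-cancelˡ-≡ (n (suc l)) _ _ (begin
      n (suc l) + suc (i′ + z′)         ≡⟨ cong (_+ suc (i′ + z′)) e ⟨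
      suc (i + z) + suc (i′ + z′)       ≡⟨ lemma i i′ z z′ ⟩
      suc (i + i′) + suc (z + z′)       ≡⟨ cong₂ _+_ ei ez ⟩
      n l + n l                         ≡⟨ ref eq ⟨
      n (suc l) + n j                   ∎)
      where open ≡-Reasoning

  word-pal : ∀ k → Pal word (n k)
  word-pal k = word-pal-≤ k k ≤-refl

  pal-gap : ∀ k {d} → n k + d ≡ n (suc k) → Period word (n (suc k)) d
  pal-gap k {d} e = subst (λ x → Period word x d) e (pal⇒period d (subst (Pal word) (sym e) (word-pal (suc k))) (word-pal k))

  -- `known` is the hypothesis of a strong induction on `m`; it makes every gap completed below `m`
  -- a least period.
  module Below {m : ℕ} (known : ∀ {m′} → m′ < m → Pal word m′ → ∃[ i ] n i ≡ m′) where

    noPal : ∀ l r → r < m → n l < r → r < n (suc l) → ¬ Pal word r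
    noPal l r r<m p q Q with known r<m Q
    ... | x , refl = between p q

    gap-least : ∀ l → n (suc l) < m → ∀ p → 0 < p → p < gap n l → ¬ Period word (n (suc l)) p
    gap-least l lt p p>0 p<d Q = noPal⇒least {m = n l} {d = gap n l}
      (subst (Pal word) (sym (y+gap l)) (word-pal (suc l)))
      (λ r lo hi → noPal l r (<-trans (subst (r <_) (y+gap l) hi) lt) lo (subst (r <_) (y+gap l) hi))
      p p>0 p<d (subst (λ x → Period word x p) (sym (y+gap l)) Q)

    -- The new letter `t` stands at position `n t`. A palindrome of length `m` would mirror it into
    -- the prefix of length `n t`, where all letters are smaller.
    letter-case : ∀ t → φ t ≡ nothing → n t < m → m < n (suc t) → ¬ Pal word m
    letter-case t eq nt<m m<nt′ P = <-irrefl refl (begin-strict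
        t                   ≡⟨ W-out t ≤-refl ⟨
        W t (n t)           ≡⟨ W-new ≤-refl (sym (letter-exact eq)) ⟨
        W (suc t) (n t)     ≡⟨ word≡W (suc t) (incr t) ⟨
        word (n t)          ≡⟨ P (n t) z ez ⟩
        word z              ≡⟨ word≡W t z<nt ⟩
        W t z               <⟨ W-< t z<nt ⟩
        t                   ∎)
      where
      open ≤-Reasoning
      z = m ∸ suc (n t)
      ez : suc (n t + z) ≡ m
      ez = m+[n∸m]≡n nt<m
      z<nt : z < n t
      z<nt = +-cancelˡ-< (suc (n t)) _ _ (subst (suc (n t) + z <_) (letter-exact eq) (subst (_< n (suc t)) (sym ez) m<nt′))

    -- Let `s` be the preceding jump. From `s` on the gap is constantly `d`, so the gap at `suc t`
    -- is a multiple of `d` plus `x = n s - n j`. Divisibility would give `d ∣ x` with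
    -- `0 < x ≤ n s`, and each form of `φ s` contradicts this.
    gap-∤ : ∀ t {j} → n (suc t) < m → φ (suc t) ≡ just j → Jump φ (suc t) → ¬ gap n t ∣ gap n (suc t)
    gap-∤ t {j} lt eq J d∣p with lastJump t
    ... | s , s≤t , Js , none with consecutive (s≤s s≤t) Js J (λ l p q → none l p (s≤s⁻¹ q)) eq
    ...   | j<s , φs≢ = by-ref (φ s) refl
      where
      d = gap n s
      d≡ : gap n t ≡ d
      d≡ = gap-const s≤t none
      a = suc t ∸ s
      s+a : s + a ≡ suc t
      s+a = m+[n∸m]≡n (m≤n⇒m≤1+n s≤t)
      nt : n (suc t) ≡ n s + a * d
      nt = trans (cong n (sym s+a)) (arithmetic s a λ l p q →
             gap-const p λ k u v → none k u (s≤s⁻¹ (≤-trans (s≤s v) (subst (l <_) s+a q))))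
      x = n s ∸ n j
      x+ : x + n j ≡ n s
      x+ = m∸n+n≡m (y-mono (<⇒≤ j<s))
      lemma : ∀ u x v → u + x + v ≡ x + v + u
      lemma = solve-∀
      gap≡ : gap n (suc t) ≡ a * d + x
      gap≡ = +-cancelʳ-≡ (n j) _ _ (begin
        gap n (suc t) + n j     ≡⟨ gap-ref eq ⟩
        n (suc t)               ≡⟨ nt ⟩
        n s + a * d             ≡⟨ cong (_+ a * d) x+ ⟨
        x + n j + a * d         ≡⟨ lemma (a * d) x (n j) ⟨
        a * d + x + n j         ∎)
        where open ≡-Reasoning
      d∣x : d ∣ x
      d∣x = ∣m+n∣m⇒∣n (subst₂ _∣_ d≡ gap≡ d∣p) (n∣m*n a)
      x>0 : 0 < x
      x>0 = m<n⇒0<n∸m (y-mono< j<s)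
      x≤ns : x ≤ n s
      x≤ns = subst (x ≤_) x+ (m≤m+n x (n j))
      d≤x : d ≤ x
      d≤x = ∣⇒≤ {{>-nonZero x>0}} d∣x
      ns<m : n s < m
      ns<m = ≤-<-trans (y-mono (m≤n⇒m≤1+n s≤t)) lt
      ns′<m : n (suc s) < m
      ns′<m = ≤-<-trans (y-mono (s≤s s≤t)) lt
      by-ref : ∀ v → φ s ≡ v → ⊥
      -- A letter at `s` makes `d` equal to `n s + 1`, which exceeds `x`.
      by-ref nothing e = <⇒≱ (s≤s (≤-trans d≤x x≤ns)) (≤-reflexive (+-cancelˡ-≡ (n s) _ _
        (trans (+-suc (n s) (n s)) (sym (trans (y+gap s) (letter-exact e))))))
      by-ref (just j′) e with m≤n⇒m<n∨m≡n d≤x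
      -- If `d` equals `x`, then `s` has the same reference `j`, which reducedness forbids.
      ... | inj₂ d≡x = φs≢ (trans e (cong just (y-injective (+-cancelˡ-≡ d _ _
              (trans (gap-ref e) (trans (sym x+) (cong (_+ n j) (sym d≡x))))))))
      ... | inj₁ d<x = deep s refl
        where
        2d≤x : d + d ≤ x
        2d≤x with properMultiple d∣x d<x
        ... | c , x≡ = subst (d + d ≤_) (sym x≡) (+-monoʳ-≤ d (m≤m+n d (c * d)))
        deep : ∀ s₀ → s₀ ≡ s → ⊥
        deep zero refl = contradiction (below e) λ ()
        -- Now `d + d ≤ n s`, so the least period `d₀` of the prefix of length `n s` divides its
        -- period `d`, properly because `s` is a jump. Then `noMultiple` excludes the palindrome of
        -- length `n (suc s)`.
        deep (suc s′) refl = finish (properMultiple d₀∣d d₀<d)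
          where
          d₀ = gap n s′
          d₀<d : d₀ < d
          d₀<d = +-cancelˡ-< (n j′) _ _ (begin-strict
            n j′ + d₀   <⟨ +-monoˡ-< d₀ (y-mono< (s≤s⁻¹ (Js j′ e))) ⟩
            n s′ + d₀   ≡⟨ y+gap s′ ⟩
            n s         ≡⟨ gap-ref e ⟨
            d + n j′    ≡⟨ +-comm d (n j′) ⟩
            n j′ + d    ∎)
            where open ≤-Reasoning
          ej : n j′ + d ≡ n s
          ej = trans (+-comm (n j′) d) (gap-ref e)
          d₀∣d : d₀ ∣ d
          d₀∣d = least-period-∣ (gap-least s′ ns<m) (gap>0 s′) (pal-gap s′ (y+gap s′)) d
            (subst (λ v → Period word v d) ej (pal⇒period d (subst (Pal word) (sym ej) (word-pal s)) (word-pal j′)))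
            (≤-trans (+-monoʳ-≤ d (<⇒≤ d₀<d)) (≤-trans 2d≤x x≤ns))
          finish : ∃[ c ] d ≡ (2 + c) * d₀ → ⊥
          finish (c , d≡c) = noMultiple c
            (λ r p q → noPal s r (<-trans (subst (r <_) e′ q) ns′<m) p (subst (r <_) e′ q))
            (gap>0 s′) (word-pal s) (pal-gap s′ (y+gap s′))
            (subst (_≤ n s) d≡c (≤-trans d≤x x≤ns))
            (subst (Pal word) (sym e′) (word-pal (suc s)))
            where
            e′ : n s + (2 + c) * d₀ ≡ n (suc s)
            e′ = trans (cong (n s +_) (sym d≡c)) (y+gap s)

    -- The excess `p′` of `m` over `N` is the least period of the prefix of length `m`, hence
    -- divides `p`; being a period of the prefix of length `N`, it is in turn divisible by `d`. So
    -- `d ∣ p`, which rules out a jump at `suc t`. But without a jump `p` equals `d`, although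
    -- `d ≤ p′ < p`.
    ref-case : ∀ t {j} → φ (suc t) ≡ just j → n (suc t) < m → m < n (2 + t) → ¬ Pal word m
    ref-case t {j} eq nt<m m<nt′ P = contradiction
        (gap-step λ J → gap-∤ t nt<m eq J d∣p) (>⇒≢ (≤-<-trans d≤p′ p′<p))
      where
      N = n (suc t)
      d = gap n t
      p = gap n (suc t)
      p′ = m ∸ N
      N+p′ : N + p′ ≡ m
      N+p′ = m+[n∸m]≡n (<⇒≤ nt<m)
      p′>0 : 0 < p′
      p′>0 = m<n⇒0<n∸m nt<m
      p′<p : p′ < p
      p′<p = +-cancelˡ-< N _ _ (subst₂ _<_ (sym N+p′) (sym (y+gap (suc t))) m<nt′)
      p≤N : p ≤ N
      p≤N = subst (p ≤_) (gap-ref eq) (m≤m+n p (n j))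
      per-p′ : Period word m p′
      per-p′ = subst (λ v → Period word v p′) N+p′ (pal⇒period p′ (subst (Pal word) (sym N+p′) P) (word-pal (suc t)))
      p′∣p : p′ ∣ p
      p′∣p = least-period-∣
        (λ r r>0 r<p′ Q → noPal⇒least (subst (Pal word) (sym N+p′) P)
          (λ v lo hi → noPal (suc t) v (subst (v <_) N+p′ hi) lo (<-trans (subst (v <_) N+p′ hi) m<nt′))
          r r>0 r<p′ (subst (λ v → Period word v r) (sym N+p′) Q))
        p′>0 per-p′ p (period-≤ (<⇒≤ m<nt′) (pal-gap (suc t) (y+gap (suc t))))
        (subst (p + p′ ≤_) N+p′ (+-monoˡ-≤ p′ p≤N))
      per-N : Period word N p′
      per-N = period-≤ (<⇒≤ nt<m) per-p′
      d≤p′ : d ≤ p′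
      d≤p′ = ≮⇒≥ λ lt → gap-least t nt<m p′ p′>0 lt per-N
      2p′≤p : p′ + p′ ≤ p
      2p′≤p with properMultiple p′∣p p′<p
      ... | c , e = subst (p′ + p′ ≤_) (sym e) (+-monoʳ-≤ p′ (m≤m+n p′ (c * p′)))
      d∣p : d ∣ p
      d∣p = ∣-trans (least-period-∣ (gap-least t nt<m) (gap>0 t) (pal-gap t (y+gap t)) p′ per-N
        (≤-trans (+-monoʳ-≤ p′ d≤p′) (≤-trans 2p′≤p p≤N))) p′∣p

    noPal-m : ∀ t → n t < m → m < n (suc t) → ¬ Pal word m
    noPal-m t lo hi with φ t in eq
    ... | nothing = letter-case t eq lo hi
    noPal-m zero lo hi | just j = contradiction (below eq) λ ()
    noPal-m (suc t) lo hi | just j = ref-case t eq lo hi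

  word-complete : ∀ m → Pal word m → ∃[ i ] n i ≡ m
  word-complete = <-rec _ λ m known P → go m known P
    where
    go : ∀ m → (∀ {m′} → m′ < m → Pal word m′ → ∃[ i ] n i ≡ m′) → Pal word m → ∃[ i ] n i ≡ m
    go m known P with locate n0 m
    ... | t , lo , hi with m≤n⇒m<n∨m≡n lo
    ...   | inj₂ e = t , e
    ...   | inj₁ lt = ⊥-elim (Below.noPal-m known t lt hi P)

  word-enum : IsPalEnum word n
  word-enum = incr , (λ i → pal⇒prefix (word-pal i)) , λ m P → word-complete m (prefix⇒pal P)

-- The reference function of a word

module RefsOf {A : Set} {w : Word A} {n : ℕ → ℕ} (E : IsPalEnum w n) where

  open Increasing (proj₁ E)

  n-incr : ∀ i → n i < n (suc i)
  n-incr = proj₁ E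

  n-pal : ∀ i → Pal w (n i)
  n-pal i = prefix⇒pal (proj₁ (proj₂ E) i)

  n-complete : ∀ m → Pal w m → ∃[ i ] n i ≡ m
  n-complete m P = proj₂ (proj₂ E) m (pal⇒prefix P)

  gap-period : ∀ i → Period w (n (suc i)) (gap n i)
  gap-period i = subst (λ x → Period w x (gap n i)) (y+gap i)
    (pal⇒period (gap n i) (subst (Pal w) (sym (y+gap i)) (n-pal (suc i))) (n-pal i))

  -- The gap is a period of the palindrome of length `n k`; cutting it off leaves a palindrome,
  -- which the enumeration must contain.
  overlap-pal : ∀ k → n (suc k) ≤ n k + n k → ∃[ j ] n (suc k) + n j ≡ n k + n k
  overlap-pal k le = proj₁ found , trans (cong (n (suc k) +_) (proj₂ found)) (m+[n∸m]≡n le)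
    where
    d = gap n k
    r = (n k + n k) ∸ n (suc k)
    lemma : ∀ a b c → a + (b + c) ≡ b + (a + c)
    lemma = solve-∀
    r+d : r + d ≡ n k
    r+d = +-cancelˡ-≡ (n k) _ _ (begin
      n k + (r + d)       ≡⟨ lemma (n k) r d ⟩
      r + (n k + d)       ≡⟨ cong (r +_) (y+gap k) ⟩
      r + n (suc k)       ≡⟨ m∸n+n≡m le ⟩
      n k + n k           ∎)
      where open ≡-Reasoning
    found : ∃[ j ] n j ≡ r
    found = n-complete r (period⇒pal (subst (Pal w) (sym r+d) (n-pal k))
      (subst (λ x → Period w x d) (sym r+d) (period-≤ (<⇒≤ (n-incr k)) (gap-period k))))

  refs : ℕ → Maybe ℕ
  refs k with n (suc k) ≤? n k + n k
  ... | yes le = just (proj₁ (overlap-pal k le))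
  ... | no _ = nothing

  refs-tracks : Tracks refs n
  refs-tracks = record { incr = n-incr ; letter = λ {i} → letter i ; ref = λ {i} → ref i }
    where
    letter : ∀ i → refs i ≡ nothing → n i + n i < n (suc i)
    letter i eq with n (suc i) ≤? n i + n i
    letter i () | yes _
    letter i eq | no ¬le = ≰⇒> ¬le
    ref : ∀ i {j} → refs i ≡ just j → n (suc i) + n j ≡ n i + n i
    ref i eq with n (suc i) ≤? n i + n i
    ref i refl | yes le = proj₂ (overlap-pal i le)
    ref i () | no _

  refs-below : ∀ {k j} → refs k ≡ just j → j < k
  refs-below {k} {j} eq = y-cancel< (+-cancelˡ-< (n k) _ _
    (subst (n k + n j <_) (Tracks.ref refs-tracks eq) (+-monoˡ-< (n j) (n-incr k))))

  open Tracking refs-below refs-tracks using (gap-ref; gap-const)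

  gap-notMultiple : ∀ t a → gap n (suc t) ≡ (2 + a) * gap n t → ¬ gap n (suc t) ≤ n (suc t)
  gap-notMultiple t a e le = noMultiple a
      (λ r p q P → let x , e″ = n-complete r P in
        between (subst (n (suc t) <_) (sym e″) p) (subst (_< n (2 + t)) (sym e″) (subst (r <_) e′ q)))
      (gap>0 t) (n-pal (suc t)) (gap-period t) (subst (_≤ n (suc t)) e le)
      (subst (Pal w) (sym e′) (n-pal (2 + t)))
    where
    e′ : n (suc t) + (2 + a) * gap n t ≡ n (2 + t)
    e′ = trans (cong (n (suc t) +_) (sym e)) (y+gap (suc t))

  -- The lengths form a progression with difference `d` from the previous jump `s` on. If `s ≤ j`,
  -- or if `s` also refers to `j`, the next gap is at least the double of `d` and a multiple of it,
  -- against `gap-notMultiple`.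
  refs-reduced : Reduced refs
  refs-reduced = record { below = refs-below ; consecutive = cons }
    where
    cons : ∀ {s t j} → s < t → Jump refs s → Jump refs t →
      (∀ l → s < l → l < t → ¬ Jump refs l) → refs t ≡ just j → (j < s) × (refs s ≢ just j)
    cons {s} {suc t} {j} s<t Js Jt none eq = ≰⇒> s≰j , φs≢
      where
      d = gap n t
      const : ∀ l → s ≤ l → l ≤ t → gap n l ≡ d
      const l p q = trans (gap-const p (λ k u v → none k u (s≤s (≤-trans v q))))
                      (sym (gap-const (≤-trans p q) (λ k u v → none k u (s≤s v))))
      progression : ∀ l → s ≤ l → l ≤ suc t → n (suc t) ≡ n l + (suc t ∸ l) * d
      progression l p q = trans (cong n (sym (m+[n∸m]≡n q))) (arithmetic l (suc t ∸ l)
        λ k u v → const k (≤-trans p u) (s≤s⁻¹ (subst (k <_) (m+[n∸m]≡n q) v)))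
      gap≤ : gap n (suc t) ≤ n (suc t)
      gap≤ = subst (gap n (suc t) ≤_) (gap-ref eq) (m≤m+n _ (n j))
      not : ∀ c → 2 ≤ c → gap n (suc t) ≢ c * d
      not (suc (suc a)) _ e = gap-notMultiple t a e gap≤
      not (suc zero) (s≤s ())
      s≰j : ¬ s ≤ j
      s≰j s≤j = not (suc t ∸ j) (m+n≤o⇒m≤o∸n 2 (Jt j eq)) (+-cancelʳ-≡ (n j) _ _
        (trans (gap-ref eq) (trans (progression j s≤j (<⇒≤ (refs-below eq))) (+-comm (n j) _))))
      φs≢ : refs s ≢ just j
      φs≢ eq′ = not (suc (suc t ∸ s)) (s≤s (m<n⇒0<n∸m s<t)) (+-cancelʳ-≡ (n j) _ _ (begin
        gap n (suc t) + n j           ≡⟨ gap-ref eq ⟩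
        n (suc t)                     ≡⟨ progression s ≤-refl (<⇒≤ s<t) ⟩
        n s + (suc t ∸ s) * d         ≡⟨ cong (_+ (suc t ∸ s) * d) (gap-ref eq′) ⟨
        gap n s + n j + (suc t ∸ s) * d   ≡⟨ cong (λ x → x + n j + (suc t ∸ s) * d) (const s ≤-refl (s≤s⁻¹ s<t)) ⟩
        d + n j + (suc t ∸ s) * d     ≡⟨ lemma d (n j) ((suc t ∸ s) * d) ⟩
        d + (suc t ∸ s) * d + n j     ∎))
        where
        open ≡-Reasoning
        lemma : ∀ a b c → a + b + c ≡ a + c + b
        lemma = solve-∀

-- Comparison of two sequences with the same reference function

-- F has increments f, and at each reference f is the sum of f over the window from φ i to i.
record Linear (φ : ℕ → Maybe ℕ) (F f : ℕ → ℕ) : Set where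
  field
    step : ∀ i → F i + f i ≡ F (suc i)
    back : ∀ {i j} → φ i ≡ just j → f i + F j ≡ F i

module _ {φ : ℕ → Maybe ℕ} where

  scale : ∀ {F f} c → Linear φ F f → Linear φ (λ i → c * F i) (λ i → c * f i)
  scale {F} {f} c A = record
    { step = λ i → trans (sym (*-distribˡ-+ c (F i) (f i))) (cong (c *_) (step i))
    ; back = λ {i} {j} eq → trans (sym (*-distribˡ-+ c (f i) (F j))) (cong (c *_) (back eq)) }
    where open Linear A

  add : ∀ {F f G g} → Linear φ F f → Linear φ G g → Linear φ (λ i → F i + G i) (λ i → f i + g i)
  add {F} {f} {G} {g} A B = record
    { step = λ i → trans (lemma (F i) (G i) (f i) (g i)) (cong₂ _+_ (A.step i) (B.step i))
    ; back = λ {i} {j} eq → trans (lemma (f i) (g i) (F j) (G j)) (cong₂ _+_ (A.back eq) (B.back eq)) }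
    where
    module A = Linear A
    module B = Linear B
    lemma : ∀ a b c d → a + b + (c + d) ≡ a + c + (b + d)
    lemma = solve-∀

  module _ {F f G g} (A : Linear φ F f) (B : Linear φ G g) where
    private
      module A = Linear A
      module B = Linear B

    -- This is `F i - F j ≤ G i - G j`, the sum of the increments over the window, with the
    -- subtractions moved across.
    telescope : ∀ {j i} → j ≤ i → (∀ l → j ≤ l → l < i → f l ≤ g l) → F i + G j ≤ G i + F j
    telescope {zero} {zero} z≤n le = ≤-reflexive (+-comm (F 0) (G 0))
    telescope {j} {suc i} j≤i le with m≤n⇒m<n∨m≡n j≤i
    ... | inj₂ refl = ≤-reflexive (+-comm (F (suc i)) (G (suc i)))
    ... | inj₁ (s≤s p) = begin
          F (suc i) + G j       ≡⟨ cong (_+ G j) (A.step i) ⟨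
          F i + f i + G j       ≡⟨ lemma (F i) (f i) (G j) ⟩
          F i + G j + f i       ≤⟨ +-mono-≤ (telescope p λ l u v → le l u (m≤n⇒m≤1+n v)) (le i p ≤-refl) ⟩
          G i + F j + g i       ≡⟨ lemma (G i) (g i) (F j) ⟨
          G i + g i + F j       ≡⟨ cong (_+ F j) (B.step i) ⟩
          G (suc i) + F j       ∎
      where
      open ≤-Reasoning
      lemma : ∀ a b c → a + b + c ≡ a + c + b
      lemma = solve-∀

    window : ∀ {i j} → φ i ≡ just j → j ≤ i → (∀ l → j ≤ l → l < i → f l ≤ g l) → f i ≤ g i
    window {i} {j} eq j≤i le = +-cancelʳ-≤ (F j + G j) _ _ (begin
        f i + (F j + G j)     ≡⟨ +-assoc (f i) _ _ ⟨
        f i + F j + G j       ≡⟨ cong (_+ G j) (A.back eq) ⟩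
        F i + G j             ≤⟨ telescope j≤i le ⟩
        G i + F j             ≡⟨ cong (_+ F j) (B.back eq) ⟨
        g i + G j + F j       ≡⟨ lemma (g i) (G j) (F j) ⟩
        g i + (F j + G j)     ∎)
      where
      open ≤-Reasoning
      lemma : ∀ a b c → a + b + c ≡ a + (c + b)
      lemma = solve-∀

    -- The window of `suc i` is that from `j` to `i` together with `i` itself, so `f (suc i) - f i`
    -- is a sum of `f` over the former. Hence `g - f` does not decrease.
    window-step : ∀ {i j} → φ (suc i) ≡ just j → j ≤ i → (∀ l → j ≤ l → l < i → f l ≤ g l) →
      f (suc i) + g i ≤ g (suc i) + f i
    window-step {i} {j} eq j≤i le = +-cancelʳ-≤ (F j + G j) _ _ (begin
        f (suc i) + g i + (F j + G j)       ≡⟨ lemma₁ (f (suc i)) (g i) (F j) (G j) ⟩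
        f (suc i) + F j + g i + G j         ≡⟨ cong (λ x → x + g i + G j) (trans (A.back eq) (sym (A.step i))) ⟩
        F i + f i + g i + G j               ≡⟨ lemma₂ (F i) (f i) (g i) (G j) ⟩
        F i + G j + (f i + g i)             ≤⟨ +-monoˡ-≤ (f i + g i) (telescope j≤i le) ⟩
        G i + F j + (f i + g i)             ≡⟨ lemma₃ (G i) (F j) (f i) (g i) ⟩
        G i + g i + f i + F j               ≡⟨ cong (λ x → x + f i + F j) (trans (B.step i) (sym (B.back eq))) ⟩
        g (suc i) + G j + f i + F j         ≡⟨ lemma₄ (g (suc i)) (G j) (f i) (F j) ⟩
        g (suc i) + f i + (F j + G j)       ∎)
      where
      open ≤-Reasoning
      lemma₁ : ∀ a b c d → a + b + (c + d) ≡ a + c + b + d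
      lemma₁ = solve-∀
      lemma₂ : ∀ a b c d → a + b + c + d ≡ a + d + (b + c)
      lemma₂ = solve-∀
      lemma₃ : ∀ a b c d → a + b + (c + d) ≡ a + d + c + b
      lemma₃ = solve-∀
      lemma₄ : ∀ a b c d → a + b + c + d ≡ a + c + (d + b)
      lemma₄ = solve-∀

-- Convergence of the quotients of gaps

module Comparison {φ : ℕ → Maybe ℕ} {y y′ : ℕ → ℕ} (R : Reduced φ) (T : Tracks φ y) (T′ : Tracks φ y′)
  (N₀ e : ℕ) (e>0 : 0 < e) (bounded : ∀ i → N₀ ≤ i → ∃[ j ] (φ i ≡ just j × y i ≤ e * y j)) where

  open Reduced R
  open Tracking below T
  private module ′ = Tracking below T′

  D D′ : ℕ → ℕ
  D = gap y
  D′ = gap y′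

  linear : Linear φ y D
  linear = record { step = y+gap ; back = gap-ref }

  linear′ : Linear φ y′ D′
  linear′ = record { step = ′.y+gap ; back = ′.gap-ref }

  -- Each round shrinks the range of the quotients by the factor `H / (H + 1)`.
  H : ℕ
  H = 8 * e

  -- Halfway at k gives slack 2 (g k − f k) ≥ x D k, and slack never decreases.  While windows still reach
  -- below k, D stays below 4e D k; afterwards the inequality is inherited from the window.
  contract : ∀ {F f G g} → Linear φ F f → Linear φ G g → ∀ x N k → N ≤ k → N₀ ≤ k →
    (∀ l → N ≤ l → f l ≤ g l) → (∀ {i j} → k ≤ i → φ i ≡ just j → N ≤ j) →
    2 * f k + x * D k ≤ 2 * g k → y k ≤ 4 * D k →
    ∀ i → k ≤ i → suc H * f i + x * D i ≤ suc H * g i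
  contract {F} {f} {G} {g} A B x N k N≤k N₀≤k le after mid good = <-rec _ go
    where
    slack : ∀ i → k ≤ i → f i + g k ≤ g i + f k
    slack zero z≤n = ≤-reflexive (+-comm (f 0) (g 0))
    slack (suc i) k≤i with m≤n⇒m<n∨m≡n k≤i
    ... | inj₂ refl = ≤-reflexive (+-comm (f k) (g k))
    ... | inj₁ (s≤s p) with bounded (suc i) (≤-trans N₀≤k k≤i)
    ...   | j , eq , _ = +-cancelʳ-≤ (g i + f i) _ _ (begin
            f (suc i) + g k + (g i + f i)     ≡⟨ lemma (f (suc i)) (g k) (g i) (f i) ⟩
            (f (suc i) + g i) + (f i + g k)   ≤⟨ +-mono-≤ (window-step A B eq (s≤s⁻¹ (below eq)) λ l u v → le l (≤-trans (after k≤i eq) u)) (slack i p) ⟩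
            (g (suc i) + f i) + (g i + f k)   ≡⟨ lemma′ (g (suc i)) (f i) (g i) (f k) ⟩
            g (suc i) + f k + (g i + f i)     ∎)
      where
      open ≤-Reasoning
      lemma : ∀ a b c d → a + b + (c + d) ≡ (a + c) + (d + b)
      lemma = solve-∀
      lemma′ : ∀ a b c d → (a + b) + (c + d) ≡ a + d + (c + b)
      lemma′ = solve-∀

    go : ∀ i → (∀ {i′} → i′ < i → k ≤ i′ → suc H * f i′ + x * D i′ ≤ suc H * g i′) → k ≤ i →
         suc H * f i + x * D i ≤ suc H * g i
    go i rec k≤i with bounded i (≤-trans N₀≤k k≤i)
    ... | j , eq , yi≤ with k ≤? j
    ...   | yes k≤j = window (add (scale (suc H) A) (scale x linear)) (scale (suc H) B) eq (<⇒≤ (below eq))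
                        λ l u v → rec v (≤-trans k≤j u)
    ...   | no k≰j = begin
          suc H * f i + x * D i                     ≤⟨ +-monoʳ-≤ (suc H * f i) (*-monoʳ-≤ x Di≤) ⟩
          suc H * f i + x * (e * (4 * D k))         ≡⟨ lemma₁ e (f i) x (D k) ⟩
          f i + 4 * e * (2 * f i + x * D k)         ≤⟨ +-mono-≤ (le i (≤-trans N≤k k≤i)) (*-monoʳ-≤ (4 * e) twice) ⟩
          g i + 4 * e * (2 * g i)                   ≡⟨ lemma₂ e (g i) ⟩
          suc H * g i                               ∎
      where
      open ≤-Reasoning
      lemma₁ : ∀ e f x d → suc (8 * e) * f + x * (e * (4 * d)) ≡ f + 4 * e * (2 * f + x * d)
      lemma₁ = solve-∀
      lemma₂ : ∀ e g → g + 4 * e * (2 * g) ≡ suc (8 * e) * g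
      lemma₂ = solve-∀
      lemma₃ : ∀ a b c d → 2 * a + b + (2 * c + 2 * d) ≡ 2 * (a + c) + (2 * d + b)
      lemma₃ = solve-∀
      lemma₄ : ∀ a b c → 2 * (a + b) + 2 * c ≡ 2 * a + (2 * c + 2 * b)
      lemma₄ = solve-∀
      Di≤ : D i ≤ e * (4 * D k)
      Di≤ = begin
        D i             ≤⟨ m≤m+n (D i) (y j) ⟩
        D i + y j       ≡⟨ gap-ref eq ⟩
        y i             ≤⟨ yi≤ ⟩
        e * y j         ≤⟨ *-monoʳ-≤ e (y-mono (<⇒≤ (≰⇒> k≰j))) ⟩
        e * y k         ≤⟨ *-monoʳ-≤ e good ⟩
        e * (4 * D k)   ∎
      twice : 2 * f i + x * D k ≤ 2 * g i
      twice = +-cancelʳ-≤ (2 * g k + 2 * f k) _ _ (begin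
        2 * f i + x * D k + (2 * g k + 2 * f k)     ≡⟨ lemma₃ (f i) (x * D k) (g k) (f k) ⟩
        2 * (f i + g k) + (2 * f k + x * D k)       ≤⟨ +-mono-≤ (*-monoʳ-≤ 2 (slack i k≤i)) mid ⟩
        2 * (g i + f k) + 2 * g k                   ≡⟨ lemma₄ (g i) (f k) (g k) ⟩
        2 * g i + (2 * g k + 2 * f k)               ∎)

  -- Induction over the jumps. The reference of a jump `t` lies before the previous jump `s`, so
  -- `D t` is at least `y t - y (pred s)`; adding the estimate at `s` and using that `D` is constant
  -- from `s` to `i` gives the one at `t`.
  jump-estimate : ∀ i → N₀ ≤ i → ∃[ s ] (s ≤ i × Jump φ s × (∀ l → s < l → l ≤ i → ¬ Jump φ l) ×
    y s ≤ y N₀ + (D s + D (pred s)))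
  jump-estimate i N₀≤i with m≤n⇒m<n∨m≡n N₀≤i
  ... | inj₂ refl with lastJump i
  ...   | s , s≤i , J , none = s , s≤i , J , none , ≤-trans (y-mono s≤i) (m≤m+n _ _)
  jump-estimate (suc i) _ | inj₁ (s≤s N₀≤i) with jump-estimate i N₀≤i | jump? φ (suc i)
  ... | s , s≤i , J , none , est | no ¬J = s , m≤n⇒m≤1+n s≤i , J , noJump-suc none ¬J , est
  ... | s , s≤i , J , none , est | yes J′ =
      suc i , ≤-refl , J′ , (λ l p q → contradiction p (≤⇒≯ q)) , est′ s refl
    where
    t = suc i
    j = proj₁ (bounded t (m≤n⇒m≤1+n N₀≤i))
    eq : φ t ≡ just j
    eq = proj₁ (proj₂ (bounded t (m≤n⇒m≤1+n N₀≤i)))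
    j<s : j < s
    j<s = proj₁ (consecutive (s≤s s≤i) J J′ (λ l p q → none l p (s≤s⁻¹ q)) eq)
    -- Since `j < s`, the jump `s` is not 0 and `pred s` is a true predecessor.
    est′ : ∀ s₀ → s₀ ≡ s → y t ≤ y N₀ + (D t + D i)
    est′ zero refl = contradiction j<s λ ()
    est′ (suc s′) refl = +-cancelʳ-≤ (y s) _ _ (begin
        y t + y s                                     ≤⟨ +-monoʳ-≤ (y t) est ⟩
        y t + (y N₀ + (D s + D s′))                   ≡⟨ cong (_+ (y N₀ + (D s + D s′))) (gap-ref eq) ⟨
        D t + y j + (y N₀ + (D s + D s′))             ≤⟨ +-monoˡ-≤ _ (+-monoʳ-≤ (D t) (y-mono (s≤s⁻¹ j<s))) ⟩
        D t + y s′ + (y N₀ + (D s + D s′))            ≡⟨ lemma (D t) (y s′) (y N₀) (D s) (D s′) ⟩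
        y N₀ + (D t + D s) + (y s′ + D s′)            ≡⟨ cong₂ (λ u v → y N₀ + (D t + u) + v) (sym (gap-const s≤i none)) (y+gap s′) ⟩
        y N₀ + (D t + D i) + y s                      ∎)
      where
      open ≤-Reasoning
      lemma : ∀ a b c d e → a + b + (c + (d + e)) ≡ c + (a + d) + (b + e)
      lemma = solve-∀

  -- The estimate bounds `y t` by `y N₀` and two gaps, of which the earlier is the smaller; `y N₀`
  -- accounts for at most half of `y t`.
  jump-large : ∀ t → N₀ < t → Jump φ t → 2 * y N₀ ≤ y t → y t ≤ 4 * D t
  jump-large t@(suc i) (s≤s N₀≤i) J big with jump-estimate t (m≤n⇒m≤1+n N₀≤i) | bounded t (m≤n⇒m≤1+n N₀≤i)
  ... | s , s≤t , _ , none , est | j , eq , _ with m≤n⇒m<n∨m≡n s≤t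
  ...   | inj₁ s<t = contradiction J (none t s<t ≤-refl)
  ...   | inj₂ refl = +-cancelˡ-≤ (y t) _ _ (begin
          y t + y t                         ≡⟨ lemma (y t) ⟩
          2 * y t                           ≤⟨ *-monoʳ-≤ 2 est ⟩
          2 * (y N₀ + (D t + D i))          ≤⟨ *-monoʳ-≤ 2 (+-monoʳ-≤ (y N₀) (+-monoʳ-≤ (D t) Di≤)) ⟩
          2 * (y N₀ + (D t + D t))          ≡⟨ lemma′ (y N₀) (D t) ⟩
          2 * y N₀ + 4 * D t                ≤⟨ +-monoˡ-≤ (4 * D t) big ⟩
          y t + 4 * D t                     ∎)
    where
    open ≤-Reasoning
    lemma : ∀ a → a + a ≡ 2 * a
    lemma = solve-∀
    lemma′ : ∀ a b → 2 * (a + (b + b)) ≡ 2 * a + 4 * b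
    lemma′ = solve-∀
    Di≤ : D i ≤ D t
    Di≤ = +-cancelˡ-≤ (y i) _ _ (begin
      y i + D i     ≡⟨ y+gap i ⟩
      y t           ≡⟨ gap-ref eq ⟨
      D t + y j     ≤⟨ +-monoʳ-≤ (D t) (y-mono (s≤s⁻¹ (below eq))) ⟩
      D t + y i     ≡⟨ +-comm (D t) (y i) ⟩
      y i + D t     ∎)

  -- After a run without jumps the next one would refer back before the run, and
  -- boundedness limits how long the run can have been; hence the search terminates.
  nextJump : ∀ N → N₀ ≤ N → (∃[ t ] (N ≤ t × Jump φ t)) ⊎ (∀ t → N ≤ t → ¬ Jump φ t)
  nextJump N N₀≤N with search (suc (e * y N))
    where
    search : ∀ b → (∃[ t ] (N ≤ t × Jump φ t)) ⊎ (∀ t → N ≤ t → t < b → ¬ Jump φ t)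
    search zero = inj₂ λ t _ ()
    search (suc b) with search b
    ... | inj₁ found = inj₁ found
    ... | inj₂ none with N ≤? b | jump? φ b
    ...   | yes p | yes J = inj₁ (b , p , J)
    ...   | yes _ | no ¬J = inj₂ λ t p q → [ none t p , (λ { refl → ¬J }) ]′ (m≤n⇒m<n∨m≡n (s≤s⁻¹ q))
    ...   | no ¬p | _ = inj₂ λ t p q → [ none t p , (λ { refl → contradiction p ¬p }) ]′ (m≤n⇒m<n∨m≡n (s≤s⁻¹ q))
  ... | inj₁ found = inj₁ found
  ... | inj₂ none = inj₂ (<-rec _ go)
    where
    go : ∀ t → (∀ {t′} → t′ < t → N ≤ t′ → ¬ Jump φ t′) → N ≤ t → ¬ Jump φ t
    go t rec N≤t J with lastJump N | bounded t (≤-trans N₀≤N N≤t)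
    ... | s , s≤N , Js , noneN | j , eq , yt≤ = none t N≤t (s≤s t≤) J
      where
      none′ : ∀ l → s < l → l < t → ¬ Jump φ l
      none′ l p q with l ≤? N
      ... | yes l≤N = noneN l p l≤N
      ... | no l≰N = rec q (<⇒≤ (≰⇒> l≰N))
      t≤ : t ≤ e * y N
      t≤ with m≤n⇒m<n∨m≡n N≤t
      ... | inj₂ refl = ≤-trans (i≤y t) (≤-trans (≤-reflexive (sym (*-identityˡ (y t)))) (*-monoˡ-≤ (y t) e>0))
      ... | inj₁ N<t = ≤-trans (i≤y t) (≤-trans yt≤ (*-monoʳ-≤ e (y-mono (≤-trans (<⇒≤ j<s) s≤N))))
        where
        j<s : j < s
        j<s = proj₁ (consecutive (≤-<-trans s≤N N<t) Js J none′ eq)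

  -- From `N` on, the quotients `D′ i / D i` lie between `L / c` and `(L + g) / c`.
  Bounds : ℕ → ℕ → ℕ → ℕ → Set
  Bounds N c L g = ∀ i → N ≤ i → (L * D i ≤ c * D′ i) × (c * D′ i ≤ (L + g) * D i)

  -- The range of the quotients has relative width at most `1 / M`.
  Near : ℕ → Set
  Near M = ∃[ N ] ∃[ c ] ∃[ L ] ∃[ g ] (0 < c × 0 < L × M * g ≤ L × Bounds N c L g)

  constant-near : ∀ N → (∀ t → N ≤ t → ¬ Jump φ t) → ∀ M → Near M
  constant-near N none M = N , D N , D′ N , 0 , gap>0 N , ′.gap>0 N , ≤-trans (≤-reflexive (*-zeroʳ M)) z≤n ,
      λ i N≤i → ≤-reflexive (e₁ i N≤i) ,
        ≤-reflexive (trans (sym (e₁ i N≤i)) (cong (_* D i) (sym (+-identityʳ (D′ N)))))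
    where
    e₁ : ∀ i → N ≤ i → D′ N * D i ≡ D N * D′ i
    e₁ i N≤i = begin
      D′ N * D i    ≡⟨ cong₂ _*_ (sym (′.gap-const N≤i none′)) (gap-const N≤i none′) ⟩
      D′ i * D N    ≡⟨ *-comm (D′ i) (D N) ⟩
      D N * D′ i    ∎
      where
      open ≡-Reasoning
      none′ : ∀ k → N < k → k ≤ i → ¬ Jump φ k
      none′ k p _ = none k (<⇒≤ p)

  -- At a late jump `t` the quotient lies in the lower or the upper half of the range. By `contract`
  -- the opposite end then moves inwards by `1 / (H + 1)` of the width. Without late jumps the
  -- quotients are constant.
  round : ∀ {N c L g} → Bounds N c L g →
    (∀ M → Near M) ⊎ (∃[ N′ ] ∃[ L′ ] (suc H * L ≤ L′ × Bounds N′ (suc H * c) L′ (H * g)))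
  round {N} {c} {L} {g} bounds with nextJump K N₀≤K
    where
    -- The summands ensure in turn that `t` lies beyond `N₀` and `N`, that windows from `t` on stay
    -- above `N`, and that `jump-large` applies.
    K = suc (N₀ + N + e * y N + 2 * y N₀)
    N₀≤K : N₀ ≤ K
    N₀≤K = m≤n⇒m≤1+n (≤-trans (m≤m+n N₀ N) (≤-trans (m≤m+n _ (e * y N)) (m≤m+n _ (2 * y N₀))))
  ... | inj₂ none = inj₁ (constant-near _ none)
  ... | inj₁ (t , K≤t , J) = inj₂ (by-half (≤-total (2 * (c * D′ t)) ((2 * L + g) * D t)))
    where
    N₀<t : N₀ < t
    N₀<t = ≤-trans (s≤s (≤-trans (m≤m+n N₀ N) (≤-trans (m≤m+n _ (e * y N)) (m≤m+n _ (2 * y N₀))))) K≤t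
    N≤t : N ≤ t
    N≤t = ≤-trans (m≤n⇒m≤1+n (≤-trans (m≤n+m N N₀) (≤-trans (m≤m+n _ (e * y N)) (m≤m+n _ (2 * y N₀))))) K≤t
    eyN<t : e * y N < t
    eyN<t = ≤-trans (s≤s (≤-trans (m≤n+m _ (N₀ + N)) (m≤m+n _ (2 * y N₀)))) K≤t
    good : y t ≤ 4 * D t
    good = jump-large t N₀<t J (≤-trans (m≤n⇒m≤1+n (m≤n+m _ (N₀ + N + e * y N))) (≤-trans K≤t (i≤y t)))
    after : ∀ {i j} → t ≤ i → φ i ≡ just j → N ≤ j
    after {i} {j} t≤i eq with bounded i (≤-trans (<⇒≤ N₀<t) t≤i)
    ... | j′ , eq′ , yi≤ with just-injective (trans (sym eq) eq′)
    ...   | refl = <⇒≤ (y-cancel< (*-cancelˡ-< e _ _ (<-≤-trans eyN<t (≤-trans t≤i (≤-trans (i≤y i) yi≤)))))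
    by-half : 2 * (c * D′ t) ≤ (2 * L + g) * D t ⊎ (2 * L + g) * D t ≤ 2 * (c * D′ t) →
      ∃[ N′ ] ∃[ L′ ] (suc H * L ≤ L′ × Bounds N′ (suc H * c) L′ (H * g))
    by-half (inj₁ low) = t , suc H * L , ≤-refl , λ i t≤i →
        (begin
          suc H * L * D i       ≡⟨ *-assoc (suc H) L (D i) ⟩
          suc H * (L * D i)     ≤⟨ *-monoʳ-≤ (suc H) (proj₁ (bounds i (≤-trans N≤t t≤i))) ⟩
          suc H * (c * D′ i)    ≡⟨ *-assoc (suc H) c (D′ i) ⟨
          suc H * c * D′ i      ∎) ,
        +-cancelʳ-≤ (g * D i) _ _ (begin
          suc H * c * D′ i + g * D i              ≡⟨ cong (_+ g * D i) (*-assoc (suc H) c (D′ i)) ⟩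
          suc H * (c * D′ i) + g * D i            ≤⟨ contract (scale c linear′) (scale (L + g) linear) g N t N≤t (<⇒≤ N₀<t)
                                                      (λ l p → proj₂ (bounds l p)) after mid good i t≤i ⟩
          suc H * ((L + g) * D i)                 ≡⟨ lemma H L g (D i) ⟩
          (suc H * L + H * g) * D i + g * D i     ∎)
      where
      open ≤-Reasoning
      lemma : ∀ h l g d → suc h * ((l + g) * d) ≡ (suc h * l + h * g) * d + g * d
      lemma = solve-∀
      lemma′ : ∀ l g d → (2 * l + g) * d + g * d ≡ 2 * ((l + g) * d)
      lemma′ = solve-∀
      mid : 2 * (c * D′ t) + g * D t ≤ 2 * ((L + g) * D t)
      mid = ≤-trans (+-monoˡ-≤ (g * D t) low) (≤-reflexive (lemma′ L g (D t)))
    by-half (inj₂ high) = t , suc H * L + g , m≤m+n _ g , λ i t≤i →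
        (begin
          (suc H * L + g) * D i             ≡⟨ lemma H L g (D i) ⟩
          suc H * (L * D i) + g * D i       ≤⟨ contract (scale L linear) (scale c linear′) g N t N≤t (<⇒≤ N₀<t)
                                                (λ l p → proj₁ (bounds l p)) after mid good i t≤i ⟩
          suc H * (c * D′ i)                ≡⟨ *-assoc (suc H) c (D′ i) ⟨
          suc H * c * D′ i                  ∎) ,
        (begin
          suc H * c * D′ i                  ≡⟨ *-assoc (suc H) c (D′ i) ⟩
          suc H * (c * D′ i)                ≤⟨ *-monoʳ-≤ (suc H) (proj₂ (bounds i (≤-trans N≤t t≤i))) ⟩
          suc H * ((L + g) * D i)           ≡⟨ lemma″ H L g (D i) ⟩
          (suc H * L + g + H * g) * D i     ∎)
      where
      open ≤-Reasoning
      lemma : ∀ h l g d → (suc h * l + g) * d ≡ suc h * (l * d) + g * d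
      lemma = solve-∀
      lemma′ : ∀ l g d → 2 * (l * d) + g * d ≡ (2 * l + g) * d
      lemma′ = solve-∀
      lemma″ : ∀ h l g d → suc h * ((l + g) * d) ≡ (suc h * l + g + h * g) * d
      lemma″ = solve-∀
      mid : 2 * (L * D t) + g * D t ≤ 2 * (c * D′ t)
      mid = ≤-trans (≤-reflexive (lemma′ L g (D t))) high

  -- `B` bounds the finitely many gaps before `N₀`, which are positive, so the quotients there lie
  -- between `1 / (B + 1)` and `B + 1`; windows carry both bounds onwards.
  initial : ∃[ B ] Bounds 0 (suc B) 1 (suc B * suc B)
  initial = B , λ i _ →
      ≤-trans (≤-reflexive (*-identityˡ (D i))) (lower i) ,
      (begin
        suc B * D′ i                      ≤⟨ *-monoʳ-≤ (suc B) (upper i) ⟩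
        suc B * (suc B * D i)             ≡⟨ *-assoc (suc B) (suc B) (D i) ⟨
        suc B * suc B * D i               ≤⟨ *-monoˡ-≤ (D i) (m≤n+m (suc B * suc B) 1) ⟩
        (1 + suc B * suc B) * D i         ∎)
    where
    open ≤-Reasoning
    bound : ∀ (f : ℕ → ℕ) N → ∃[ b ] (∀ l → l < N → f l ≤ b)
    bound f zero = 0 , λ l ()
    bound f (suc N) with bound f N
    ... | b , le = b + f N , λ l p → [ (λ q → ≤-trans (le l q) (m≤m+n b (f N))) , (λ { refl → m≤n+m (f N) b }) ]′ (m≤n⇒m<n∨m≡n (s≤s⁻¹ p))
    B = proj₁ (bound (λ l → D l + D′ l) N₀)
    B≥ : ∀ l → l < N₀ → D l + D′ l ≤ B
    B≥ = proj₂ (bound (λ l → D l + D′ l) N₀)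
    enlarge : ∀ {a d} → a ≤ B → 0 < d → a ≤ suc B * d
    enlarge {a} {d} le d>0 = ≤-trans (m≤n⇒m≤1+n le) (≤-trans (≤-reflexive (sym (*-identityʳ (suc B)))) (*-monoʳ-≤ (suc B) d>0))
    everywhere : ∀ {F f G g} → Linear φ F f → Linear φ G g → (∀ l → l < N₀ → f l ≤ g l) → ∀ i → f i ≤ g i
    everywhere {f = f} {g = g} A C start = <-rec _ go
      where
      go : ∀ i → (∀ {i′} → i′ < i → f i′ ≤ g i′) → f i ≤ g i
      go i rec with i <? N₀
      ... | yes lt = start i lt
      ... | no ¬lt with bounded i (≮⇒≥ ¬lt)
      ...   | j , eq , _ = window A C eq (<⇒≤ (below eq)) λ l _ v → rec v
    lower : ∀ i → D i ≤ suc B * D′ i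
    lower = everywhere linear (scale (suc B) linear′) λ l p → enlarge (≤-trans (m≤m+n _ _) (B≥ l p)) (′.gap>0 l)
    upper : ∀ i → D′ i ≤ suc B * D i
    upper = everywhere linear′ (scale (suc B) linear) λ l p → enlarge (≤-trans (m≤n+m _ _) (B≥ l p)) (gap>0 l)

  g₀ : ℕ
  g₀ = suc (proj₁ initial) * suc (proj₁ initial)

  -- After `K` rounds the relative width is at most `g₀ * (H / (H + 1)) ^ K`.
  iterate : ∀ K → (∀ M → Near M) ⊎
    (∃[ N ] ∃[ c ] ∃[ L ] (0 < c × suc H ^ K ≤ L × Bounds N c L (H ^ K * g₀)))
  iterate zero = inj₂ (0 , suc (proj₁ initial) , 1 , s≤s z≤n , ≤-refl ,
    subst (Bounds 0 (suc (proj₁ initial)) 1) (sym (+-identityʳ g₀)) (proj₂ initial))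
  iterate (suc K) with iterate K
  ... | inj₁ near = inj₁ near
  ... | inj₂ (N , c , L , c>0 , L≥ , bounds) with round {N} {c} {L} {H ^ K * g₀} bounds
  ...   | inj₁ near = inj₁ near
  ...   | inj₂ (N′ , L′ , L≤L′ , bounds′) = inj₂ (N′ , suc H * c , L′ , <-≤-trans c>0 (m≤m+n c (H * c)) ,
            ≤-trans (*-monoʳ-≤ (suc H) L≥) L≤L′ ,
            subst (Bounds N′ (suc H * c) L′) (sym (*-assoc H (H ^ K) g₀)) bounds′)

  near : ∀ M → Near M
  near M with iterate (H * (g₀ * M))
  ... | inj₁ n = n M
  ... | inj₂ (N , c , L , c>0 , L≥ , bounds) = N , c , L , H ^ K * g₀ , c>0 , <-≤-trans (m^n>0 (suc H) K) L≥ , ≤-trans small L≥ , bounds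
    where
    -- With this `K` the Bernoulli bound `1 + K / H` exceeds `g₀ * M`.
    K = H * (g₀ * M)
    H>0 : 0 < H
    H>0 = ≤-trans e>0 (m≤m+n e (7 * e))
    -- Bernoulli's inequality for `(1 + 1 / H) ^ k`, cleared of denominators.
    bernoulli : ∀ k → H ^ k * (H + k) ≤ H * suc H ^ k
    bernoulli zero = ≤-reflexive (lemma H)
      where
      lemma : ∀ h → 1 * (h + 0) ≡ h * 1
      lemma = solve-∀
    bernoulli (suc k) = begin
        H * H ^ k * (H + suc k)             ≤⟨ m≤m+n _ (H ^ k * k) ⟩
        H * H ^ k * (H + suc k) + H ^ k * k ≡⟨ lemma H (H ^ k) k ⟩
        suc H * (H ^ k * (H + k))           ≤⟨ *-monoʳ-≤ (suc H) (bernoulli k) ⟩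
        suc H * (H * suc H ^ k)             ≡⟨ lemma′ H (suc H ^ k) ⟩
        H * (suc H * suc H ^ k)             ∎
      where
      open ≤-Reasoning
      lemma : ∀ h p k → h * p * (h + suc k) + p * k ≡ suc h * (p * (h + k))
      lemma = solve-∀
      lemma′ : ∀ h p → suc h * (h * p) ≡ h * (suc h * p)
      lemma′ = solve-∀
    small : M * (H ^ K * g₀) ≤ suc H ^ K
    small = *-cancelˡ-≤ H {{>-nonZero H>0}} (begin
        H * (M * (H ^ K * g₀))    ≡⟨ lemma H M (H ^ K) g₀ ⟩
        H ^ K * K                 ≤⟨ *-monoʳ-≤ (H ^ K) (m≤n+m K H) ⟩
        H ^ K * (H + K)           ≤⟨ bernoulli K ⟩
        H * suc H ^ K             ∎)
      where
      open ≤-Reasoning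
      lemma : ∀ h m p g → h * (m * (p * g)) ≡ p * (h * (g * m))
      lemma = solve-∀

  -- One factor `(M + 1) / M` pays for the width of the range of quotients, the other for the
  -- initial values when the gap bounds are summed to compare `y` with `y′`.
  gap-transfer : ∀ a b M → 0 < M → (∀ i → N₀ ≤ i → b * D i ≤ a * y i) →
    ∃[ N ] (∀ i → N ≤ i → M * M * b * D′ i ≤ suc M * suc M * a * y′ i)
  gap-transfer a b M M>0 hyp with near M
  -- Beyond the last summand, `y N` is at most `y i / (M + 1)`.
  ... | N , c , L , g , c>0 , L>0 , Mg≤L , bounds = N₀ + N + suc M * y N , λ i le →
      *-cancelˡ-≤ c {{>-nonZero c>0}} (begin
        c * (M * M * b * D′ i)              ≡⟨ lemma₁ c M b (D′ i) ⟩
        M * M * b * (c * D′ i)              ≤⟨ *-monoʳ-≤ (M * M * b) (proj₂ (bounds i (N≤ i le))) ⟩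
        M * M * b * ((L + g) * D i)         ≡⟨ lemma₂ M b L g (D i) ⟩
        (M * L + M * g) * (M * (b * D i))   ≤⟨ *-mono-≤ (+-monoʳ-≤ (M * L) Mg≤L) (*-monoʳ-≤ M (hyp i (N₀≤ i le))) ⟩
        (M * L + L) * (M * (a * y i))       ≡⟨ lemma₃ M L a (y i) ⟩
        suc M * a * (M * (L * y i))         ≤⟨ *-monoʳ-≤ (suc M * a) (y-compare i le) ⟩
        suc M * a * (suc M * (c * y′ i))    ≡⟨ lemma₄ M a c (y′ i) ⟩
        c * (suc M * suc M * a * y′ i)      ∎)
    where
    open ≤-Reasoning
    N₀≤ : ∀ i → N₀ + N + suc M * y N ≤ i → N₀ ≤ i
    N₀≤ i le = ≤-trans (≤-trans (m≤m+n N₀ N) (m≤m+n _ (suc M * y N))) le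
    N≤ : ∀ i → N₀ + N + suc M * y N ≤ i → N ≤ i
    N≤ i le = ≤-trans (≤-trans (m≤n+m N N₀) (m≤m+n _ (suc M * y N))) le
    lemma₁ : ∀ c m b d → c * (m * m * b * d) ≡ m * m * b * (c * d)
    lemma₁ = solve-∀
    lemma₂ : ∀ m b l g d → m * m * b * ((l + g) * d) ≡ (m * l + m * g) * (m * (b * d))
    lemma₂ = solve-∀
    lemma₃ : ∀ m l a y → (m * l + l) * (m * (a * y)) ≡ suc m * a * (m * (l * y))
    lemma₃ = solve-∀
    lemma₄ : ∀ m a c y → suc m * a * (suc m * (c * y)) ≡ c * (suc m * suc m * a * y)
    lemma₄ = solve-∀
    lemma₅ : ∀ m l y → m * (l * y) + l * y ≡ suc m * (l * y)
    lemma₅ = solve-∀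
    lemma₆ : ∀ m c y l z → suc m * (c * y + l * z) ≡ suc m * (c * y) + l * (suc m * z)
    lemma₆ = solve-∀
    y-compare : ∀ i → N₀ + N + suc M * y N ≤ i → M * (L * y i) ≤ suc M * (c * y′ i)
    y-compare i le = +-cancelʳ-≤ (L * y i) _ _ (begin
      M * (L * y i) + L * y i                     ≡⟨ lemma₅ M L (y i) ⟩
      suc M * (L * y i)                           ≤⟨ *-monoʳ-≤ (suc M) (≤-trans (m≤m+n _ (c * y′ N))
                                                      (telescope (scale L linear) (scale c linear′) (N≤ i le) λ l p _ → proj₁ (bounds l p))) ⟩
      suc M * (c * y′ i + L * y N)                ≡⟨ lemma₆ M c (y′ i) L (y N) ⟩
      suc M * (c * y′ i) + L * (suc M * y N)      ≤⟨ +-monoʳ-≤ (suc M * (c * y′ i)) (*-monoʳ-≤ L (≤-trans (≤-trans (m≤n+m _ (N₀ + N)) le) (i≤y i))) ⟩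
      suc M * (c * y′ i) + L * y i                ∎)

-- From functions ψ to references and back

nth-++ˡ : ∀ xs {ys} i → i < length xs → nth (xs ++ ys) i ≡ nth xs i
nth-++ˡ (x ∷ xs) zero _ = refl
nth-++ˡ (x ∷ xs) (suc i) (s≤s lt) = nth-++ˡ xs i lt

nth-last : ∀ xs {v} k → length xs ≡ k → nth (xs ++ (v ∷ [])) k ≡ v
nth-last [] zero e = refl
nth-last (x ∷ xs) (suc k) e = nth-last xs k (suc-injective e)

module _ {A : Set} (ψ : ℕ → ℕ ⊎ A) where

  refsψ : ℕ → Maybe ℕ
  refsψ k with ψ (suc k)
  ... | inj₁ m = just (pred m)
  ... | inj₂ _ = nothing

  jump⇒special : IsFunction ψ → ∀ k → Jump refsψ k → Special ψ (suc k)
  jump⇒special fn k J with ψ (suc k) in eq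
  ... | inj₂ a = s≤s z≤n , inj₁ (a , refl)
  ... | inj₁ m with fn (suc k) (s≤s z≤n) m eq
  jump⇒special fn k J | inj₁ (suc j) | s≤s z≤n , _ = s≤s z≤n ,
    inj₂ (suc j , refl , s≤s z≤n , subst (_≤ suc k) (+-comm 2 (suc j)) (s≤s (J j refl)))

  special⇒jump : ∀ k → Special ψ (suc k) → Jump refsψ k
  special⇒jump k S j e with ψ (suc k)
  special⇒jump k (_ , inj₁ (_ , ())) j e | inj₁ _
  special⇒jump k (_ , inj₂ (suc m , refl , _ , le)) j refl | inj₁ _ = s≤s⁻¹ (subst (_≤ suc k) (+-comm (suc m) 2) le)
  special⇒jump k S j () | inj₂ _

  reducedψ : IsReduced ψ → Reduced refsψ
  reducedψ (fn , red) = record { below = λ {k} → below′ k ; consecutive = cons }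
    where
    below′ : ∀ k {j} → refsψ k ≡ just j → j < k
    below′ k e with ψ (suc k) in eq
    below′ k e | inj₁ m with fn (suc k) (s≤s z≤n) m eq
    below′ k refl | inj₁ (suc j) | _ , le = s≤s⁻¹ (subst (_≤ suc k) (+-comm (suc j) 1) le)
    cons : ∀ {s t j} → s < t → Jump refsψ s → Jump refsψ t →
      (∀ l → s < l → l < t → ¬ Jump refsψ l) → refsψ t ≡ just j → (j < s) × (refsψ s ≢ just j)
    cons {s} {t} {j} s<t Js Jt none e with red (suc s) (suc t) (s≤s s<t) (jump⇒special fn s Js) (jump⇒special fn t Jt)
      (λ { (suc l) (s≤s p) (s≤s q) S → none l p q (special⇒jump l S) })
    ... | ψ≢ , below-or-letter = j<s below-or-letter e , λ e′ → ψ≢ (trans (value t e) (sym (value s e′)))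
      where
      value : ∀ k {j} → refsψ k ≡ just j → ψ (suc k) ≡ inj₁ (suc j)
      value k e with ψ (suc k) in eq
      value k e | inj₁ m with fn (suc k) (s≤s z≤n) m eq
      value k refl | inj₁ (suc j) | _ = refl
      j<s : IsLetter (ψ (suc t)) ⊎ (∃[ p ] (ψ (suc t) ≡ inj₁ p × p < suc s)) → refsψ t ≡ just j → j < s
      j<s v e with ψ (suc t) | value t e
      j<s (inj₁ (_ , ())) e | _ | refl
      j<s (inj₂ (_ , refl , p<)) e | _ | refl = s≤s⁻¹ p<

  length-firsts : ∀ k → length (firsts ψ k) ≡ suc k
  length-firsts zero = refl
  length-firsts (suc k) = trans (length-++ (firsts ψ k)) (trans (cong (_+ 1) (length-firsts k)) (+-comm (suc k) 1))

  nth-firsts : ∀ k {i} → i ≤ k → nth (firsts ψ k) i ≡ seqψ ψ i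
  nth-firsts zero z≤n = refl
  nth-firsts (suc k) {i} le with m≤n⇒m<n∨m≡n le
  ... | inj₁ (s≤s i≤k) = trans (nth-++ˡ (firsts ψ k) i (subst (i <_) (sym (length-firsts k)) (s≤s i≤k))) (nth-firsts k i≤k)
  ... | inj₂ refl = refl

  seq-letter : ∀ k → refsψ k ≡ nothing → seqψ ψ (suc k) ≡ 2 * seqψ ψ k + 1
  seq-letter k e with ψ (suc k)
  ... | inj₂ _ = nth-last (firsts ψ k) (suc k) (length-firsts k)

  seq-ref : ∀ k {j} → refsψ k ≡ just j → seqψ ψ (suc k) ≡ 2 * seqψ ψ k ∸ nth (firsts ψ k) j
  seq-ref k e with ψ (suc k)
  seq-ref k refl | inj₁ m = nth-last (firsts ψ k) (suc k) (length-firsts k)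

  module Sequence (R : Reduced refsψ) where
    open Reduced R

    n : ℕ → ℕ
    n = seqψ ψ

    double : ∀ x → 2 * x ≡ x + x
    double x = cong (_+_ x) (+-identityʳ x)

    ref-∸ : ∀ {k j} → refsψ k ≡ just j → n (suc k) ≡ n k + n k ∸ n j
    ref-∸ {k} e = trans (seq-ref k e) (cong₂ _∸_ (double (n k)) (nth-firsts k (<⇒≤ (below e))))

    letter-exact : ∀ {k} → refsψ k ≡ nothing → n (suc k) ≡ suc (n k + n k)
    letter-exact {k} e = trans (seq-letter k e) (trans (+-comm _ 1) (cong suc (double (n k))))

    -- Growth at a reference needs `n j < n l`, which is monotonicity below `l`; hence the mutual
    -- induction.
    n-incr-≤ : ∀ k l → l < k → n l < n (suc l)
    n-mono-≤ : ∀ k j → j < k → n j < n k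
    n-incr-≤ (suc k) l l<k with refsψ l in eq
    ... | nothing = subst (n l <_) (sym (letter-exact eq)) (s≤s (m≤m+n (n l) (n l)))
    ... | just j = subst (n l <_) (sym (ref-∸ eq)) (subst (n l <_) (sym (+-∸-assoc (n l) (<⇒≤ nj<nl))) (m<m+n (n l) (m<n⇒0<n∸m nj<nl)))
      where
      nj<nl : n j < n l
      nj<nl = n-mono-≤ l j (below eq)
    n-mono-≤ (suc k) j (s≤s le) with m≤n⇒m<n∨m≡n le
    ... | inj₁ lt = <-trans (n-mono-≤ k j lt) (n-incr-≤ (suc k) k ≤-refl)
    ... | inj₂ refl = n-incr-≤ (suc k) k ≤-refl

    tracks : Tracks refsψ n
    tracks = record
      { incr = λ i → n-mono-≤ (suc i) i ≤-refl
      ; letter = λ e → ≤-reflexive (sym (letter-exact e))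
      ; ref = λ {i} e → trans (cong (_+ _) (ref-∸ e))
          (m∸n+n≡m (≤-trans (<⇒≤ (n-mono-≤ i _ (below e))) (m≤m+n (n i) (n i)))) }

    abundant : AbundantSeq n
    abundant k with refsψ k in eq
    ... | nothing = ≤-reflexive (seq-letter k eq)
    ... | just j = subst (_≤ 2 * n k + 1) (sym (seq-ref k eq)) (≤-trans (m∸n≤m (2 * n k) (nth (firsts ψ k) j)) (m≤m+n _ 1))

-- Using the position as the letter makes all letters distinct.
fresh : (ℕ → Maybe ℕ) → ℕ → ℕ ⊎ ℕ
fresh φ zero = inj₁ 0
fresh φ (suc k) with φ k
... | just j = inj₁ (suc j)
... | nothing = inj₂ k

module Fresh {φ : ℕ → Maybe ℕ} (R : Reduced φ) where
  open Reduced R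

  ψ : ℕ → ℕ ⊎ ℕ
  ψ = fresh φ

  refs-fresh : ∀ k → refsψ ψ k ≡ φ k
  refs-fresh k with φ k
  ... | just j = refl
  ... | nothing = refl

  letter-value : ∀ k → φ k ≡ nothing → ψ (suc k) ≡ inj₂ k
  letter-value k eq rewrite eq = refl

  ref-value : ∀ k {j} → φ k ≡ just j → ψ (suc k) ≡ inj₁ (suc j)
  ref-value k eq rewrite eq = refl

  letter⁻¹ : ∀ k {b} → ψ (suc k) ≡ inj₂ b → b ≡ k
  letter⁻¹ k e with φ k
  letter⁻¹ k refl | nothing = refl

  ref⁻¹ : ∀ k {j} → ψ (suc k) ≡ inj₁ (suc j) → φ k ≡ just j
  ref⁻¹ k e with φ k
  ref⁻¹ k refl | just j = refl

  fresh-reduced : IsReduced ψ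
  fresh-reduced = isFunction , cons
    where
    isFunction : IsFunction ψ
    isFunction (suc k) _ m e with φ k in eq
    isFunction (suc k) _ _ refl | just j = s≤s z≤n , subst (_≤ suc k) (+-comm 1 (suc j)) (s≤s (below eq))
    to : ∀ k → Special ψ (suc k) → Jump φ k
    to k S j e = special⇒jump ψ k S j (trans (refs-fresh k) e)
    from : ∀ k → Jump φ k → Special ψ (suc k)
    from k J = jump⇒special ψ isFunction k λ j e → J j (trans (sym (refs-fresh k)) e)
    cons : ∀ s t → s < t → Special ψ s → Special ψ t → (∀ j → s < j → j < t → ¬ Special ψ j) →
      (ψ t ≢ ψ s) × (IsLetter (ψ t) ⊎ ∃[ p ] (ψ t ≡ inj₁ p × p < s))
    cons (suc s) (suc t) (s≤s s<t) Ss St none = by-ref (φ t) refl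
      where
      by-ref : ∀ v → φ t ≡ v → (ψ (suc t) ≢ ψ (suc s)) × (IsLetter (ψ (suc t)) ⊎ ∃[ p ] (ψ (suc t) ≡ inj₁ p × p < suc s))
      by-ref nothing eq = (λ e → <⇒≢ s<t (sym (letter⁻¹ s (trans (sym e) (letter-value t eq))))) , inj₁ (t , letter-value t eq)
      by-ref (just j) eq =
          (λ e → proj₂ c (ref⁻¹ s (trans (sym e) (ref-value t eq)))) , inj₂ (suc j , ref-value t eq , s≤s (proj₁ c))
        where
        c = consecutive s<t (to s Ss) (to t St) (λ l p q J → none (suc l) (s≤s p) (s≤s q) (from l J)) eq

  fresh-tracks : Tracks φ (seqψ ψ)
  fresh-tracks = record
      { incr = incr
      ; letter = λ {i} e → letter (trans (refs-fresh i) e)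
      ; ref = λ {i} e → ref (trans (refs-fresh i) e) }
    where open Tracks (Sequence.tracks ψ (reducedψ ψ fresh-reduced))

-- Limsups through natural numbers

-- limsup y (i+1) / y i < p / (s+1)
RatioBelow : (ℕ → ℕ) → ℕ → ℕ → Set
RatioBelow y p s = ∃[ a ] ∃[ r ] ∃[ N ] (a * suc s < p * suc r × (∀ i → N ≤ i → y (suc i) * suc r ≤ a * y i))

toℚᵘ-toℚ : ∀ x → toℚᵘ (toℚ x) ℚᵘ.≃ mkℚᵘ (ℤ.+ x) 0
toℚᵘ-toℚ x = toℚᵘ-fromℚᵘ (mkℚᵘ (ℤ.+ x) 0)

toℚᵘ-*-toℚ : ∀ q z → toℚᵘ (q ℚ.* toℚ z) ℚᵘ.≃ toℚᵘ q ℚᵘ.* mkℚᵘ (ℤ.+ z) 0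
toℚᵘ-*-toℚ q z = ℚᵘ.≃-trans (toℚᵘ-homo-* q (toℚ z)) (ℚᵘ.*-congˡ {toℚᵘ q} (toℚᵘ-toℚ z))

≤-toℚᵘ : ∀ x q z → toℚ x ℚ.≤ q ℚ.* toℚ z → mkℚᵘ (ℤ.+ x) 0 ℚᵘ.≤ toℚᵘ q ℚᵘ.* mkℚᵘ (ℤ.+ z) 0
≤-toℚᵘ x q z le = ℚᵘ.≤-respʳ-≃ (toℚᵘ-*-toℚ q z) (ℚᵘ.≤-respˡ-≃ (toℚᵘ-toℚ x) (toℚᵘ-mono-≤ le))


frac-lhs : ∀ x r → ℤ.+ x ℤ.* (ℤ.+ suc (pred (suc r * 1))) ≡ ℤ.+ (x * suc r)
frac-lhs x r = trans (sym (ℤ.pos-* x _)) (cong (λ v → ℤ.+ (x * v)) (*-identityʳ (suc r)))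

frac-rhs : ∀ a z → ℤ.+ a ℤ.* ℤ.+ z ℤ.* ℤ.+ 1 ≡ ℤ.+ (a * z)
frac-rhs a z = trans (ℤ.*-identityʳ _) (sym (ℤ.pos-* a z))

≤-frac : ∀ x a r z → mkℚᵘ (ℤ.+ x) 0 ℚᵘ.≤ mkℚᵘ (ℤ.+ a) r ℚᵘ.* mkℚᵘ (ℤ.+ z) 0 → x * suc r ≤ a * z
≤-frac x a r z (ℚᵘ.*≤* le) = ℤ.drop‿+≤+ (subst₂ ℤ._≤_ (frac-lhs x r) (frac-rhs a z) le)

frac-≤ : ∀ x a r z → x * suc r ≤ a * z → mkℚᵘ (ℤ.+ x) 0 ℚᵘ.≤ mkℚᵘ (ℤ.+ a) r ℚᵘ.* mkℚᵘ (ℤ.+ z) 0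
frac-≤ x a r z le = ℚᵘ.*≤* (subst₂ ℤ._≤_ (sym (frac-lhs x r)) (sym (frac-rhs a z)) (ℤ.+≤+ le))

¬≤-negative : ∀ x a r z → 0 < x → ¬ mkℚᵘ (ℤ.+ x) 0 ℚᵘ.≤ mkℚᵘ -[1+ a ] r ℚᵘ.* mkℚᵘ (ℤ.+ z) 0
¬≤-negative (suc x) a r zero _ (ℚᵘ.*≤* le)
  with subst (_ ℤ.≤_) (trans (ℤ.*-identityʳ (-[1+ a ] ℤ.* ℤ.+ 0)) (ℤ.*-zeroʳ -[1+ a ])) le
... | ℤ.+≤+ ()
¬≤-negative (suc x) a r (suc z) _ (ℚᵘ.*≤* ())

module _ {y : ℕ → ℕ} (incr : ∀ i → y i < y (suc i)) where

  limsup⇒ratio : ∀ {p s} .{c : Coprime p (suc s)} → LimsupLt y (mkℚ (ℤ.+ p) s c) → RatioBelow y p s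
  limsup⇒ratio {p} {s} (mkℚ (ℤ.+ a) r _ , q′<q , N , le) = a , r , N , lt (toℚᵘ-mono-< q′<q) ,
      λ i N≤i → ≤-frac (y (suc i)) a r (y i) (≤-toℚᵘ (y (suc i)) _ (y i) (le i N≤i))
    where
    lt : mkℚᵘ (ℤ.+ a) r ℚᵘ.< mkℚᵘ (ℤ.+ p) s → a * suc s < p * suc r
    lt (ℚᵘ.*<* l) = ℤ.drop‿+<+ (subst₂ ℤ._<_ (sym (ℤ.pos-* a (suc s))) (sym (ℤ.pos-* p (suc r))) l)
  limsup⇒ratio (mkℚ -[1+ a ] r _ , _ , N , le) =
    ⊥-elim (¬≤-negative (y (suc N)) a r (y N) (≤-<-trans z≤n (incr N)) (≤-toℚᵘ (y (suc N)) _ (y N) (le N ≤-refl)))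

  ¬limsup-negative : ∀ {p s} .{c : Coprime (suc p) (suc s)} → ¬ LimsupLt y (mkℚ -[1+ p ] s c)
  ¬limsup-negative (mkℚ (ℤ.+ a) r _ , ℚ.*<* lt , _) with subst (ℤ._< _) (sym (ℤ.pos-* a _)) lt
  ... | ()
  ¬limsup-negative (mkℚ -[1+ a ] r _ , _ , N , le) =
    ¬≤-negative (y (suc N)) a r (y N) (≤-<-trans z≤n (incr N)) (≤-toℚᵘ (y (suc N)) _ (y N) (le N ≤-refl))

  ratio⇒limsup : ∀ {p s} .{c : Coprime p (suc s)} → RatioBelow y p s → LimsupLt y (mkℚ (ℤ.+ p) s c)
  ratio⇒limsup {p} {s} (a , r , N , lt , le) = fromℚᵘ (mkℚᵘ (ℤ.+ a) r) ,
    toℚᵘ-cancel-< (ℚᵘ.<-respˡ-≃ (ℚᵘ.≃-sym (toℚᵘ-fromℚᵘ (mkℚᵘ (ℤ.+ a) r)))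
      (ℚᵘ.*<* (subst₂ ℤ._<_ (ℤ.pos-* a (suc s)) (ℤ.pos-* p (suc r)) (ℤ.+<+ lt)))) ,
    N , λ i N≤i → toℚᵘ-cancel-≤ (ℚᵘ.≤-respʳ-≃ (ℚᵘ.≃-sym (ℚᵘ.≃-trans
        (toℚᵘ-*-toℚ (fromℚᵘ (mkℚᵘ (ℤ.+ a) r)) (y i)) (ℚᵘ.*-congʳ {mkℚᵘ (ℤ.+ y i) 0} (toℚᵘ-fromℚᵘ (mkℚᵘ (ℤ.+ a) r)))))
      (ℚᵘ.≤-respˡ-≃ (ℚᵘ.≃-sym (toℚᵘ-toℚ (y (suc i)))) (frac-≤ (y (suc i)) a r (y i) (le i N≤i))))

  ratio≥1 : ∀ {a r i} → y (suc i) * suc r ≤ a * y i → suc r ≤ a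
  ratio≥1 {a} {r} {i} le = ≮⇒≥ λ lt → <⇒≱ (begin-strict
      a * y i             ≤⟨ *-monoˡ-≤ (y i) (<⇒≤ lt) ⟩
      suc r * y i         <⟨ *-monoʳ-< (suc r) (incr i) ⟩
      suc r * y (suc i)   ≡⟨ *-comm (suc r) (y (suc i)) ⟩
      y (suc i) * suc r   ∎) le
    where open ≤-Reasoning

  ¬limsup<1 : ¬ LimsupLt y (toℚ 1)
  ¬limsup<1 L with limsup⇒ratio L
  ... | a , r , N , lt , le = <⇒≱ (subst₂ _<_ (*-identityʳ a) (+-identityʳ (suc r)) lt) (ratio≥1 (le N ≤-refl))

  module _ (ab : AbundantSeq y) where

    abundant-ratio : ∀ p s → 2 * suc s < p → RatioBelow y p s
    -- The ratio is `2 + 1 / (2 * S)`, below `2 + 1 / S`; from index `2 * S` on it absorbs the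
    -- summand 1. The denominator is stored as its predecessor.
    abundant-ratio p s lt = 4 * S + 1 , pred (2 * S) , 2 * S ,
        (begin-strict
          (4 * S + 1) * S       <⟨ m<m+n _ (s≤s z≤n) ⟩
          (4 * S + 1) * S + S   ≡⟨ lemma S ⟩
          suc (2 * S) * (2 * S) ≤⟨ *-monoˡ-≤ (2 * S) lt ⟩
          p * (2 * S)           ∎) ,
        λ i le → begin
          y (suc i) * (2 * S)         ≤⟨ *-monoˡ-≤ (2 * S) (ab i) ⟩
          (2 * y i + 1) * (2 * S)     ≡⟨ lemma′ (y i) S ⟩
          4 * S * y i + 2 * S         ≤⟨ +-monoʳ-≤ (4 * S * y i) (≤-trans le (Increasing.i≤y incr i)) ⟩
          4 * S * y i + y i           ≡⟨ lemma″ S (y i) ⟩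
          (4 * S + 1) * y i           ∎
      where
      open ≤-Reasoning
      S = suc s
      lemma : ∀ s → (4 * s + 1) * s + s ≡ suc (2 * s) * (2 * s)
      lemma = solve-∀
      lemma′ : ∀ y s → (2 * y + 1) * (2 * s) ≡ 4 * s * y + 2 * s
      lemma′ = solve-∀
      lemma″ : ∀ s y → 4 * s * y + y ≡ (4 * s + 1) * y
      lemma″ = solve-∀

    abundant-limsup : LimsupIn12 y
    abundant-limsup = ¬limsup<1 , above
      where
      above : ∀ q → toℚ 2 ℚ.< q → LimsupLt y q
      above (mkℚ (ℤ.+ p) s c) (ℚ.*<* lt) = ratio⇒limsup (abundant-ratio p s
        (subst (2 * suc s <_) (*-identityʳ p) (ℤ.drop‿+<+ (subst (λ v → ℤ.+ (2 * suc s) ℤ.< v) (sym (ℤ.pos-* p 1)) lt))))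
      above (mkℚ -[1+ p ] s c) (ℚ.*<* ())

-- Limsups of sequences with the same references

module _ {φ : ℕ → Maybe ℕ} (R : Reduced φ) where

  -- A ratio bound below 2 excludes late letters and keeps the referred value at least `y i / b`, as
  -- `Comparison` requires. The gaps of `y` are at most `a₀ / b` times `y`, and `gap-transfer`
  -- carries this to `y′` with a small loss.
  transfer : ∀ {y y′} → Tracks φ y → Tracks φ y′ → ∀ {p s} → p ≤ 2 * suc s → RatioBelow y p s → RatioBelow y′ p s
  transfer {y} {y′} T T′ {p} {s} p≤ (a , r , N , lt , le) =
      M * M * b + suc M * suc M * a₀ , pred (M * M * b) , proj₁ result , lt′ , λ i N≤i → (begin
        y′ (suc i) * (M * M * b)                            ≡⟨ cong (_* (M * M * b)) (′.y+gap i) ⟨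
        (y′ i + gap y′ i) * (M * M * b)                     ≡⟨ lemma₁ (y′ i) (gap y′ i) (M * M * b) ⟩
        M * M * b * y′ i + M * M * b * gap y′ i             ≤⟨ +-monoʳ-≤ (M * M * b * y′ i) (proj₂ result i N≤i) ⟩
        M * M * b * y′ i + suc M * suc M * a₀ * y′ i        ≡⟨ *-distribʳ-+ (y′ i) (M * M * b) (suc M * suc M * a₀) ⟨
        (M * M * b + suc M * suc M * a₀) * y′ i             ∎)
    where
    open ≤-Reasoning
    open Tracks T
    open Increasing incr
    module ′ = Increasing (Tracks.incr T′)
    b = suc r
    S = suc s
    a₀ = a ∸ b
    b+a₀ : b + a₀ ≡ a
    b+a₀ = m+[n∸m]≡n (ratio≥1 incr (le N ≤-refl))
    -- Integrality leaves room 1 in `a * S < p * b`. The loss fits if `(2 * M + 1) * u < M * M` for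
    -- `u = a₀ * S`, which holds for `M = 3 * u + 1`.
    M = suc (3 * (a₀ * S))
    a<2b : a < 2 * b
    a<2b = *-cancelʳ-< S _ _ (begin-strict
      a * S           <⟨ lt ⟩
      p * b           ≤⟨ *-monoˡ-≤ b p≤ ⟩
      2 * S * b       ≡⟨ lemma S b ⟩
      2 * b * S       ∎)
      where
      lemma : ∀ s b → 2 * s * b ≡ 2 * b * s
      lemma = solve-∀
    lemma₁ : ∀ y d m → (y + d) * m ≡ m * y + m * d
    lemma₁ = solve-∀
    gap≤ : ∀ i → N ≤ i → b * gap y i ≤ a₀ * y i
    gap≤ i N≤i = +-cancelˡ-≤ (b * y i) _ _ (begin
      b * y i + b * gap y i     ≡⟨ lemma₁ (y i) (gap y i) b ⟨
      (y i + gap y i) * b       ≡⟨ cong (_* b) (y+gap i) ⟩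
      y (suc i) * b             ≤⟨ le i N≤i ⟩
      a * y i                   ≡⟨ cong (_* y i) b+a₀ ⟨
      (b + a₀) * y i            ≡⟨ *-distribʳ-+ (y i) b a₀ ⟩
      b * y i + a₀ * y i        ∎)
    bounded : ∀ i → N ≤ i → ∃[ j ] (φ i ≡ just j × y i ≤ b * y j)
    bounded i N≤i with φ i in eq
    ... | nothing = contradiction (le i N≤i) (<⇒≱ (begin-strict
            a * y i             ≤⟨ *-monoˡ-≤ (y i) (<⇒≤ a<2b) ⟩
            2 * b * y i         ≡⟨ lemma b (y i) ⟩
            (y i + y i) * b     <⟨ *-monoˡ-< b (letter eq) ⟩
            y (suc i) * b       ∎))
      where
      lemma : ∀ b y → 2 * b * y ≡ (y + y) * b
      lemma = solve-∀
    -- Here `a < 2 * b` enters as `a + 1 ≤ 2 * b`; the spare `y i` is what `b * y j` must cover.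
    ... | just j = j , refl , +-cancelˡ-≤ (a * y i) _ _ (begin
            a * y i + y i               ≡⟨ +-comm (a * y i) (y i) ⟩
            suc a * y i                 ≤⟨ *-monoˡ-≤ (y i) a<2b ⟩
            2 * b * y i                 ≡⟨ lemma b (y i) ⟩
            b * (y i + y i)             ≡⟨ cong (b *_) (ref eq) ⟨
            b * (y (suc i) + y j)       ≡⟨ lemma′ b (y (suc i)) (y j) ⟩
            y (suc i) * b + b * y j     ≤⟨ +-monoˡ-≤ (b * y j) (le i N≤i) ⟩
            a * y i + b * y j           ∎)
      where
      lemma : ∀ b y → 2 * b * y ≡ b * (y + y)
      lemma = solve-∀
      lemma′ : ∀ b u v → b * (u + v) ≡ u * b + b * v
      lemma′ = solve-∀
    result : ∃[ N′ ] (∀ i → N′ ≤ i → M * M * b * gap y′ i ≤ suc M * suc M * a₀ * y′ i)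
    result = Comparison.gap-transfer R T T′ N b (s≤s z≤n) bounded a₀ b M (s≤s z≤n) gap≤
    lt′ : (M * M * b + suc M * suc M * a₀) * S < p * (M * M * b)
    lt′ = begin-strict
      (M * M * b + suc M * suc M * a₀) * S                                     <⟨ m<m+n _ (s≤s z≤n) ⟩
      (M * M * b + suc M * suc M * a₀) * S + suc (3 * u + 3 * (u * u))         ≡⟨ lemma b a₀ S ⟩
      M * M * suc ((b + a₀) * S)                                               ≡⟨ cong (λ v → M * M * suc (v * S)) b+a₀ ⟩
      M * M * suc (a * S)                                                      ≤⟨ *-monoʳ-≤ (M * M) lt ⟩
      M * M * (p * b)                                                          ≡⟨ lemma′ M p b ⟩
      p * (M * M * b)                                                          ∎
      where
      u = a₀ * S
      lemma : ∀ b a s → (suc (3 * (a * s)) * suc (3 * (a * s)) * b + suc (suc (3 * (a * s))) * suc (suc (3 * (a * s))) * a) * s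
          + suc (3 * (a * s) + 3 * (a * s * (a * s))) ≡ suc (3 * (a * s)) * suc (3 * (a * s)) * suc ((b + a) * s)
      lemma = solve-∀
      lemma′ : ∀ m p b → m * m * (p * b) ≡ p * (m * m * b)
      lemma′ = solve-∀

  -- Cuts above 2 hold for both sequences by hypothesis, negative cuts for neither; the others are
  -- transferred.
  sameLimsup : ∀ {y y′} → Tracks φ y → Tracks φ y′ →
    (∀ q → toℚ 2 ℚ.< q → LimsupLt y q) → (∀ q → toℚ 2 ℚ.< q → LimsupLt y′ q) → SameLimsup y y′
  sameLimsup T T′ above above′ q = one T T′ above′ q , one T′ T above q
    where
    one : ∀ {y y′} → Tracks φ y → Tracks φ y′ → (∀ q → toℚ 2 ℚ.< q → LimsupLt y′ q) → ∀ q → LimsupLt y q → LimsupLt y′ q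
    one T T′ above (mkℚ -[1+ p ] s c) L = ⊥-elim (¬limsup-negative (Tracks.incr T) L)
    one T T′ above q@(mkℚ (ℤ.+ p) s c) L with p ≤? 2 * suc s
    ... | yes p≤ = ratio⇒limsup (Tracks.incr T′) (transfer T T′ p≤ (limsup⇒ratio (Tracks.incr T) L))
    ... | no p≰ = above q (ℚ.*<* (subst (λ v → ℤ.+ (2 * suc s) ℤ.< v) (ℤ.pos-* p 1)
                    (ℤ.+<+ (subst (2 * suc s <_) (sym (*-identityʳ p)) (≰⇒> p≰)))))

-- The inclusions between the sets of limsups

D∩[1,2]⊆δ : ∀ (A : Set) (w : Word A) (n : ℕ → ℕ) → IsPalEnum w n → LimsupIn12 n →
  ∃[ B ] ∃[ ψ ] (IsReduced {B} ψ × SameLimsup n (seqψ ψ))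
D∩[1,2]⊆δ A w n E (_ , above) = ℕ , ψ , fresh-reduced ,
    -- The two sequences share their references but may differ; only their limsups are compared.
    sameLimsup refs-reduced refs-tracks fresh-tracks above
      (proj₂ (abundant-limsup (Tracks.incr fresh-tracks) (Sequence.abundant ψ (reducedψ ψ fresh-reduced))))
  where
  open RefsOf E
  open Fresh refs-reduced

-- The sequence of `ψ` is itself the enumeration for the constructed word, so both limsups are
-- literally the same.
δ⊆D₀ : ∀ (B : Set) (ψ : ℕ → ℕ ⊎ B) → IsReduced ψ →
  ∃[ A ] ∃[ w ] ∃[ n ] (IsPalEnum {A} w n × AbundantSeq n × SameLimsup n (seqψ ψ))
δ⊆D₀ B ψ red = ℕ , word , seqψ ψ , word-enum , abundant , λ q → (λ L → L) , (λ L → L)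
  where
  open Sequence ψ (reducedψ ψ red)
  open WordFrom (reducedψ ψ red) tracks refl letter-exact

theorem6p3 : (∀ (A : Set) (w : Word A) (n : ℕ → ℕ) → IsPalEnum w n → AbundantSeq n →
    ∃[ B ] ∃[ ψ ] (IsReduced {B} ψ × SameLimsup n (seqψ ψ)))
    ×
    (∀ (B : Set) (ψ : ℕ → ℕ ⊎ B) → IsReduced ψ →
    ∃[ A ] ∃[ w ] ∃[ n ] (IsPalEnum {A} w n × AbundantSeq n × SameLimsup n (seqψ ψ)))
    ×
    (∀ (A : Set) (w : Word A) (n : ℕ → ℕ) → IsPalEnum w n → LimsupIn12 n →
    ∃[ B ] ∃[ ψ ] (IsReduced {B} ψ × SameLimsup n (seqψ ψ)))
    ×
    (∀ (B : Set) (ψ : ℕ → ℕ ⊎ B) → IsReduced ψ →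
    ∃[ A ] ∃[ w ] ∃[ n ] (IsPalEnum {A} w n × LimsupIn12 n × SameLimsup n (seqψ ψ)))
theorem6p3 =
  -- Abundance places the limsup in [1,2], which derives the first inclusion from the third and the
  -- fourth from the second.
  (λ A w n E ab → D∩[1,2]⊆δ A w n E (abundant-limsup (proj₁ E) ab)) ,
  δ⊆D₀ ,
  D∩[1,2]⊆δ ,
  λ B ψ red → let A , w , n , E , ab , same = δ⊆D₀ B ψ red in A , w , n , E , abundant-limsup (proj₁ E) ab , same
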